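{- Let $r\ge 5$ and let $M$ be a simple ternary matroid (i.e. representable over $GF(3)$) of rank $r$ that contains a loose element and has no coloops. If $r>10$, then $|E(M)|\le \left\lfloor \frac{41r-101}{2}\right\rfloor$. If $r\le 10$, then $|E(M)|\le \left\lfloor \frac{35r-35}{2}\right\rfloor$.
   Context: All matroids are finite. An element $t$ of a matroid $M$ is loose if every circuit of $M$ containing $t$ has size at least the rank $r(M)$. -}

module Defs where

open import Algebra.Apartness.Bundles using (HeytingCommutativeRing; HeytingField)
open import Algebra.Bundles using (CommutativeRing)
open import Data.Fin.Base using (Fin; toℕ)
open import Data.Fin.Patterns using (0F; 1F; 2F)
open import Data.Fin.Properties using (_≟_; all?; ≡-decSetoid)
open import Data.Fin.Subset
  using (Subset; inside; outside; ⊥; ⁅_⁆; _∈_; _∉_; _⊆_; _⊂_; _∪_; ∣_∣)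
open import Data.List.Base using (List; []; _∷_; _++_; map; filter)
open import Data.List.Extrema.Nat using (max)
open import Data.Nat.Base as ℕ using (ℕ; zero; suc)
open import Data.Nat.DivMod using (_mod_)
open import Data.Product.Base using (Σ; ∃; _×_; _,_; proj₁; proj₂)
import Data.Vec.Base as Vec
open import Function.Bundles using (_⇔_)
open import Level using (0ℓ; _⊔_)
open import Relation.Binary.PropositionalEquality
  using (_≡_; _≢_; refl; isEquivalence; cong₂)
import Relation.Binary.Properties.DecSetoid as DecSetoidProperties
open import Relation.Nullary.Decidable using (from-yes)
open import Relation.Nullary.Negation using (¬_; contradiction)
open import Relation.Unary using (Pred; Decidable)

-- A matroid with ground set E(M) = Fin n, so that |E(M)| = n.
-- Decidability of independence is automatic classically; as a field it makes
-- the rank computable.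
record Matroid (n : ℕ) : Set₁ where
  field
    Indep      : Pred (Subset n) 0ℓ
    indep?     : Decidable Indep
    ⊥-indep    : Indep ⊥
    hereditary : ∀ {I J} → J ⊆ I → Indep I → Indep J
    augment    : ∀ {I J} → Indep I → Indep J → ∣ I ∣ ℕ.< ∣ J ∣ →
                 ∃ λ e → e ∈ J × e ∉ I × Indep (I ∪ ⁅ e ⁆)

subsets : ∀ n → List (Subset n)
subsets zero    = Vec.[] ∷ []
subsets (suc n) = map (outside Vec.∷_) (subsets n) ++ map (inside Vec.∷_) (subsets n)

module _ {n : ℕ} (M : Matroid n) where
  open Matroid M

  rank : ℕ
  rank = max 0 (map ∣_∣ (filter indep? (subsets n)))

  IsBasis : Subset n → Set
  IsBasis B = Indep B × (∀ {I} → Indep I → B ⊆ I → I ≡ B)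

  IsCircuit : Subset n → Set
  IsCircuit C = ¬ Indep C × (∀ {D} → D ⊂ C → Indep D)

  IsLoop : Fin n → Set
  IsLoop e = IsCircuit ⁅ e ⁆

  Parallel : Fin n → Fin n → Set
  Parallel e f = e ≢ f × IsCircuit (⁅ e ⁆ ∪ ⁅ f ⁆)

  Simple : Set
  Simple = (∀ e → ¬ IsLoop e) × (∀ e f → ¬ Parallel e f)

  IsColoop : Fin n → Set
  IsColoop e = ∀ {B} → IsBasis B → e ∈ B

  IsLoose : Fin n → Set
  IsLoose t = ∀ {C} → IsCircuit C → t ∈ C → rank ℕ.≤ ∣ C ∣

module _ {c ℓ₁ ℓ₂} (F : HeytingField c ℓ₁ ℓ₂) where
  open HeytingField F using (heytingCommutativeRing)
  open HeytingCommutativeRing heytingCommutativeRing using (commutativeRing)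
  open CommutativeRing commutativeRing using (Carrier; _≈_; _*_; 0#; +-monoid)
  open import Algebra.Properties.Monoid.Sum +-monoid using (sum)

  -- Linear independence of the family of columns of A indexed by X (so a
  -- repeated column is dependent): the coefficients a range over all of Fin n
  -- but are required to vanish outside X.
  ColumnsIndependent : ∀ {m n} → (Fin m → Fin n → Carrier) → Subset n → Set (c ⊔ ℓ₁)
  ColumnsIndependent {n = n} A X =
    (a : Fin n → Carrier) →
    (∀ j → j ∉ X → a j ≈ 0#) →
    (∀ i → sum (λ j → a j * A i j) ≈ 0#) →
    ∀ j → a j ≈ 0#

  Representable : ∀ {n} → Matroid n → Set (c ⊔ ℓ₁)
  Representable {n} M =
    Σ ℕ λ m → Σ (Fin m → Fin n → Carrier) λ A →
    ∀ X → Matroid.Indep M X ⇔ ColumnsIndependent A X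

module GF3 where
  infixl 6 _+_
  infixl 7 _*_
  infix  8 -_

  _+_ : Fin 3 → Fin 3 → Fin 3
  x + y = (toℕ x ℕ.+ toℕ y) mod 3

  _*_ : Fin 3 → Fin 3 → Fin 3
  x * y = (toℕ x ℕ.* toℕ y) mod 3

  -_ : Fin 3 → Fin 3
  - x = (3 ℕ.∸ toℕ x) mod 3

  commutativeRing : CommutativeRing 0ℓ 0ℓ
  commutativeRing = record
    { Carrier = Fin 3 ; _≈_ = _≡_
    ; _+_ = _+_ ; _*_ = _*_ ; -_ = -_ ; 0# = 0F ; 1# = 1F
    ; isCommutativeRing = record
      { isRing = record
        { +-isAbelianGroup = record
          { isGroup = record
            { isMonoid = record
              { isSemigroup = record
                { isMagma = record { isEquivalence = isEquivalence ; ∙-cong = cong₂ _+_ }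
                ; assoc = from-yes (all? λ x → all? λ y → all? λ z →
                    ((x + y) + z) ≟ (x + (y + z)))
                }
              ; identity = from-yes (all? λ x → (0F + x) ≟ x)
                         , from-yes (all? λ x → (x + 0F) ≟ x)
              }
            ; inverse = from-yes (all? λ x → (- x + x) ≟ 0F)
                      , from-yes (all? λ x → (x + - x) ≟ 0F)
            ; ⁻¹-cong = λ { refl → refl }
            }
          ; comm = from-yes (all? λ x → all? λ y → (x + y) ≟ (y + x))
          }
        ; *-cong = cong₂ _*_
        ; *-assoc = from-yes (all? λ x → all? λ y → all? λ z →
            ((x * y) * z) ≟ (x * (y * z)))
        ; *-identity = from-yes (all? λ x → (1F * x) ≟ x)
                     , from-yes (all? λ x → (x * 1F) ≟ x)
        ; distrib = from-yes (all? λ x → all? λ y → all? λ z →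
                      (x * (y + z)) ≟ (x * y + x * z))
                  , from-yes (all? λ x → all? λ y → all? λ z →
                      ((y + z) * x) ≟ (y * x + z * x))
        }
      ; *-comm = from-yes (all? λ x → all? λ y → (x * y) ≟ (y * x))
      }
    }

  open CommutativeRing commutativeRing using (_-_; isCommutativeRing)
  open import Algebra.Definitions {A = Fin 3} _≡_ using (Invertible)
  open DecSetoidProperties (≡-decSetoid 3) using (≉-isApartnessRelation; ≉-tight)

  ≢⇒invertible : ∀ {x y} → x ≢ y → Invertible 1F _*_ (x - y)
  ≢⇒invertible {0F} {0F} x≢y = contradiction refl x≢y
  ≢⇒invertible {0F} {1F} x≢y = 2F , refl , refl
  ≢⇒invertible {0F} {2F} x≢y = 1F , refl , refl
  ≢⇒invertible {1F} {0F} x≢y = 1F , refl , refl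
  ≢⇒invertible {1F} {1F} x≢y = contradiction refl x≢y
  ≢⇒invertible {1F} {2F} x≢y = 2F , refl , refl
  ≢⇒invertible {2F} {0F} x≢y = 2F , refl , refl
  ≢⇒invertible {2F} {1F} x≢y = 1F , refl , refl
  ≢⇒invertible {2F} {2F} x≢y = contradiction refl x≢y

  invertible⇒≢ : ∀ {x y} → Invertible 1F _*_ (x - y) → x ≢ y
  invertible⇒≢ {0F} (0F , () , _) refl
  invertible⇒≢ {0F} (1F , () , _) refl
  invertible⇒≢ {0F} (2F , () , _) refl
  invertible⇒≢ {1F} (0F , () , _) refl
  invertible⇒≢ {1F} (1F , () , _) refl
  invertible⇒≢ {1F} (2F , () , _) refl
  invertible⇒≢ {2F} (0F , () , _) refl
  invertible⇒≢ {2F} (1F , () , _) refl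
  invertible⇒≢ {2F} (2F , () , _) refl

  heytingField : HeytingField 0ℓ 0ℓ 0ℓ
  heytingField = record
    { _≈_ = _≡_ ; _#_ = _≢_
    ; isHeytingField = record
      { isHeytingCommutativeRing = record
        { isCommutativeRing   = isCommutativeRing
        ; isApartnessRelation = ≉-isApartnessRelation
        ; #⇒invertible        = ≢⇒invertible
        ; invertible⇒#        = invertible⇒≢
        }
      ; tight = ≉-tight
      }
    }

Ternary : ∀ {n} → Matroid n → Set
Ternary = Representable GF3.heytingField

{-# OPTIONS --safe #-}
module Submission where

-- A relation is a vector a with A a = 0, where the columns of A represent M.
-- Eliminating entries of a relation a with a t ≠ 0 while keeping the entry at
-- t leads to a circuit through t, so looseness says that every such relation
-- has weight at least the rank.  Fix a of minimum weight, let S be its support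
-- without t, and expand every element e ≠ t in a basis consisting of S and at
-- most one further element b₀.  If a combination u of k such expansions has no
-- b₀-component, then replacing u by the k elements in a ± u yields a relation
-- through t, and minimality forces u to agree with ±a in at most k coordinates
-- of S.  After scaling, the expansions without b₀ and those with b₀-coefficient
-- 1 form two sets of vectors over GF(3), on which these bounds are applied to
-- combinations of at most three elements.  Deleting a coordinate from the
-- former loses at most 4 vectors.  In the latter, a vector with at least two
-- preimages under the deletion gains one agreement; this strengthens the
-- bounds and leaves at most 6 such vectors, so at most 12 are lost.  Hence
-- n ≤ 1 + (4∣S∣ + 1) + (12∣S∣ + 1), and n ≤ 1 + (4∣S∣ + 1) when S is itself a
-- basis; both are at most 35(r − 1)/2.

open import Defs
open import Algebra.Apartness.Bundles using (HeytingField; HeytingCommutativeRing)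
open import Algebra.Bundles using (CommutativeRing)
open import Data.Bool.Base using (Bool; true; false; _∧_; _∨_; not; if_then_else_)
open import Data.Fin.Base using (Fin; zero; suc; punchIn)
open import Data.Fin.Patterns using (0F; 1F; 2F)
open import Data.Fin.Properties using (_≟_; all?; any?; suc-injective; sequence; punchIn-injective; punchInᵢ≢i)
open import Data.Fin.Subset using (Subset; inside; outside; ⊥; ⁅_⁆; _∈_; _∉_; _⊆_; _⊂_; _∪_; ∣_∣) renaming (_-_ to _∖ˢ_)
open import Data.Fin.Subset.Properties using (_∈?_; ∣⊥∣≡0; ∣⁅x⁆∣≡1; x∈⁅x⁆; x∈⁅y⁆⇒x≡y; x∉⁅y⁆⇒x≢y; p⊆q⇒∣p∣≤∣q∣; p⊂q⇒∣p∣<∣q∣; ∣p∣≤∣x∷p∣; p─⊥≡p; p─q⊆p; x∈p⇒p-x⊂p; x∈p∧x≢y⇒x∈p-y; p⊆p∪q; q⊆p∪q; x∈p∪q⁻; ⊆-⊂-trans)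
open import Data.List.Base using (map; filter)
open import Data.List.Extrema.Nat using (xs≤max; argmax-sel)
open import Data.List.Membership.Propositional using () renaming (_∈_ to _∈ˡ_)
open import Data.List.Membership.Propositional.Properties using (∈-map⁺; ∈-map⁻; ∈-filter⁺; ∈-filter⁻; ∈-++⁺ˡ; ∈-++⁺ʳ)
import Data.List.Relation.Unary.All as All
open import Data.List.Relation.Unary.Any using () renaming (here to hereˡ)
open import Data.Nat.Base using (ℕ; zero; suc; z≤n; s≤s; s≤s⁻¹; _≤_; _<_; _+_; _*_; _∸_; _/_)
open import Data.Nat.DivMod using (m*n/n≡m; /-monoˡ-≤)
open import Data.Nat.Induction using (<-wellFounded)
open import Data.Nat.Properties as ℕ using (_≤?_; module ≤-Reasoning)
open import Data.Nat.Solver using (module +-*-Solver)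
open import Data.Product.Base using (∃; _×_; _,_; proj₁; proj₂)
open import Data.Sum.Base using (_⊎_; inj₁; inj₂; [_,_]′)
open import Data.Vec.Base as Vec using (Vec; []; _∷_; here; there; tabulate; zipWith)
open import Data.Vec.Properties using (≡-dec; ∷-injectiveˡ; ∷-injectiveʳ; lookup∘tabulate; lookup⇒[]=; []=⇒lookup)
open import Effect.Monad using (RawMonad)
open import Function.Base using (_∘_; id)
open import Function.Bundles using (_⇔_; Equivalence)
open import Induction.WellFounded using (Acc; acc)
open import Relation.Binary.PropositionalEquality using (_≡_; _≢_; _≗_; refl; sym; trans; cong; cong₂; subst; module ≡-Reasoning)
open import Relation.Nullary.Decidable using (Dec; does; yes; no; dec-true; dec-false; decidable-stable; from-yes; ¬?; _→-dec_; _⊎-dec_; _×-dec_)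
open import Relation.Nullary.Negation using (¬_; contradiction; ¬¬-Monad)
import Algebra.Properties.CommutativeSemigroup ℕ.+-commutativeSemigroup as ℕ+
open +-*-Solver using (solve; _:+_; _:*_; _:=_; con)
open GF3 using () renaming (_+_ to _+₃_; _*_ to _*₃_; -_ to -₃_)

-- Vectors over GF(3) and the number of their entries with a given value.

F : Set
F = Fin 3

+-identityʳ : ∀ x → x +₃ 0F ≡ x
+-identityʳ = from-yes (all? λ x → (x +₃ 0F) ≟ x)

*-zeroʳ : ∀ x → x *₃ 0F ≡ 0F
*-zeroʳ = from-yes (all? λ x → (x *₃ 0F) ≟ 0F)

x-x≡0 : ∀ x → x +₃ -₃ x ≡ 0F
x-x≡0 = from-yes (all? λ x → (x +₃ -₃ x) ≟ 0F)

x+y*0≡x : ∀ x y → x +₃ y *₃ 0F ≡ x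
x+y*0≡x = from-yes (all? λ x → all? λ y → (x +₃ y *₃ 0F) ≟ x)

infixl 6 _⊕_ _⊖_

_⊕_ _⊖_ : ∀ {m} → Vec F m → Vec F m → Vec F m
_⊕_ = zipWith _+₃_
_⊖_ = zipWith (λ x y → x +₃ -₃ y)

occ : ∀ {m} → F → Vec F m → ℕ
occ s = Vec.count (_≟ s)

occ-here : ∀ {m} {s x : F} (v : Vec F m) → x ≡ s → occ s (x ∷ v) ≡ suc (occ s v)
occ-here {s = s} v refl = cong (λ b → (if b then suc else (λ k → k)) (occ s v)) (dec-true (s ≟ s) refl)

occ-tail : ∀ {m} (s x : F) (v : Vec F m) → occ s v ≤ occ s (x ∷ v)
occ-tail s x v with does (x ≟ s)
... | true  = ℕ.n≤1+n _
... | false = ℕ.≤-refl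

occ-here-≤ : ∀ {m k} {s x : F} (v : Vec F m) → x ≡ s → occ s (x ∷ v) ≤ suc k → occ s v ≤ k
occ-here-≤ v x≡s le = s≤s⁻¹ (subst (_≤ _) (occ-here v x≡s) le)

occ-tail-≤ : ∀ {m k} (s x : F) (v : Vec F m) → occ s (x ∷ v) ≤ k → occ s v ≤ k
occ-tail-≤ s x v = ℕ.≤-trans (occ-tail s x v)

occ-here-≰0 : ∀ {m} {s x : F} (v : Vec F m) → x ≡ s → ¬ (occ s (x ∷ v) ≤ 0)
occ-here-≰0 v x≡s le = contradiction (subst (_≤ 0) (occ-here v x≡s) le) λ ()

-- In characteristic 3 doubling is negation. A bound on a sum of three vectors with a repeated term
-- thus bounds a difference.
⊕-⊕ : ∀ {m} (v w : Vec F m) → v ⊕ w ⊕ w ≡ v ⊖ w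
⊕-⊕ []      []      = refl
⊕-⊕ (x ∷ v) (y ∷ w) = cong₂ _∷_ (x+y+y x y) (⊕-⊕ v w)
  where
  x+y+y : ∀ x y → x +₃ y +₃ y ≡ x +₃ -₃ y
  x+y+y = from-yes (all? λ x → all? λ y → (x +₃ y +₃ y) ≟ (x +₃ -₃ y))

-- A nonzero element of GF(3) is `s` or its negative, and swapping the vectors exchanges the two, so
-- every coordinate where they differ is counted in one of the two orders.
occ-⊖-≤0⇒≡ : ∀ {m} s → s ≢ 0F → (v w : Vec F m) →
             occ s (v ⊖ w) ≤ 0 → occ s (w ⊖ v) ≤ 0 → v ≡ w
occ-⊖-≤0⇒≡ s s≢0 [] [] _ _ = refl
occ-⊖-≤0⇒≡ s s≢0 (x ∷ v) (y ∷ w) le ge = cong₂ _∷_ x≡y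
  (occ-⊖-≤0⇒≡ s s≢0 v w (occ-tail-≤ s (x +₃ -₃ y) (v ⊖ w) le) (occ-tail-≤ s (y +₃ -₃ x) (w ⊖ v) ge))
  where
  ≡-or-diff : ∀ s x y → s ≢ 0F → x +₃ -₃ y ≢ s → y +₃ -₃ x ≢ s → x ≡ y
  ≡-or-diff = from-yes (all? λ s → all? λ x → all? λ y →
    ¬? (s ≟ 0F) →-dec ¬? ((x +₃ -₃ y) ≟ s) →-dec ¬? ((y +₃ -₃ x) ≟ s) →-dec (x ≟ y))
  x≡y = ≡-or-diff s x y s≢0 (λ e → occ-here-≰0 (v ⊖ w) e le) (λ e → occ-here-≰0 (w ⊖ v) e ge)

-- Sets of vectors: cardinalities and agreement bounds.

∑ : ∀ {m} → (Vec F m → ℕ) → ℕ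
∑ {zero}  f = f []
∑ {suc m} f = ∑ (f ∘ (0F ∷_)) + (∑ (f ∘ (1F ∷_)) + ∑ (f ∘ (2F ∷_)))

∑-mono : ∀ {m} {f g : Vec F m → ℕ} → (∀ v → f v ≤ g v) → ∑ f ≤ ∑ g
∑-mono {zero}  f≤g = f≤g []
∑-mono {suc m} f≤g = ℕ.+-mono-≤ (∑-mono (f≤g ∘ (0F ∷_)))
  (ℕ.+-mono-≤ (∑-mono (f≤g ∘ (1F ∷_))) (∑-mono (f≤g ∘ (2F ∷_))))

∑-distrib-+ : ∀ {m} (f g : Vec F m → ℕ) → ∑ (λ v → f v + g v) ≡ ∑ f + ∑ g
∑-distrib-+ {zero}  f g = refl
∑-distrib-+ {suc m} f g = trans
  (cong₂ _+_ (∑-distrib-+ (f ∘ (0F ∷_)) (g ∘ (0F ∷_)))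
    (cong₂ _+_ (∑-distrib-+ (f ∘ (1F ∷_)) (g ∘ (1F ∷_)))
                 (∑-distrib-+ (f ∘ (2F ∷_)) (g ∘ (2F ∷_)))))
  (solve 6 (λ a b c d e h → (a :+ b) :+ ((c :+ d) :+ (e :+ h)) :=
                            (a :+ (c :+ e)) :+ (b :+ (d :+ h))) refl
    (∑ (f ∘ (0F ∷_))) (∑ (g ∘ (0F ∷_))) (∑ (f ∘ (1F ∷_)))
    (∑ (g ∘ (1F ∷_))) (∑ (f ∘ (2F ∷_))) (∑ (g ∘ (2F ∷_))))

⟦_⟧ : Bool → ℕ
⟦ b ⟧ = if b then 1 else 0

VecSet : ℕ → Set
VecSet m = Vec F m → Bool

# : ∀ {m} → VecSet m → ℕ
# f = ∑ (λ v → ⟦ f v ⟧)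

infix 4 _∈ᵛ_
_∈ᵛ_ : ∀ {m} → Vec F m → VecSet m → Set
v ∈ᵛ f = f v ≡ true

slice : ∀ {m} → VecSet (suc m) → F → VecSet m
slice f x v = f (x ∷ v)

#-empty : ∀ {m} {f : VecSet m} → (∀ v → ¬ v ∈ᵛ f) → # f ≡ 0
#-empty {zero}  {f} ∉f with f [] in eq
... | true  = contradiction eq (∉f [])
... | false = refl
#-empty {suc m} ∉f = cong₂ _+_ (#-empty (∉f ∘ (0F ∷_)))
  (cong₂ _+_ (#-empty (∉f ∘ (1F ∷_))) (#-empty (∉f ∘ (2F ∷_))))

nonempty? : ∀ {m} (f : VecSet m) → Dec (∃ (_∈ᵛ f))
nonempty? {zero}  f with f [] in eq
... | true  = yes ([] , eq)
... | false = no λ { ([] , eq′) → contradiction (trans (sym eq) eq′) λ () }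
nonempty? {suc m} f with nonempty? (slice f 0F) | nonempty? (slice f 1F) | nonempty? (slice f 2F)
... | yes (v , p) | _           | _           = yes (0F ∷ v , p)
... | no _        | yes (v , p) | _           = yes (1F ∷ v , p)
... | no _        | no _        | yes (v , p) = yes (2F ∷ v , p)
... | no p        | no q        | no r        = no λ
  { (0F ∷ v , e) → p (v , e) ; (1F ∷ v , e) → q (v , e) ; (2F ∷ v , e) → r (v , e) }

#-split : ∀ {m} (f : VecSet (suc m)) h s → s ≢ 0F →
          # f ≡ # (slice f h) + (# (slice f (h +₃ s)) + # (slice f (h +₃ -₃ s)))
#-split f h  0F s≢0 = contradiction refl s≢0
#-split f 0F 1F _   = refl
#-split f 0F 2F _   = cong (# (slice f 0F) +_) (ℕ.+-comm (# (slice f 1F)) (# (slice f 2F)))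
#-split f 1F 1F _   = solve 3 (λ a b c → a :+ (b :+ c) := b :+ (c :+ a)) refl
  (# (slice f 0F)) (# (slice f 1F)) (# (slice f 2F))
#-split f 1F 2F _   = solve 3 (λ a b c → a :+ (b :+ c) := b :+ (a :+ c)) refl
  (# (slice f 0F)) (# (slice f 1F)) (# (slice f 2F))
#-split f 2F 1F _   = solve 3 (λ a b c → a :+ (b :+ c) := c :+ (a :+ b)) refl
  (# (slice f 0F)) (# (slice f 1F)) (# (slice f 2F))
#-split f 2F 2F _   = solve 3 (λ a b c → a :+ (b :+ c) := c :+ (b :+ a)) refl
  (# (slice f 0F)) (# (slice f 1F)) (# (slice f 2F))

x+1≢x : ∀ x → x +₃ 1F ≢ x
x+1≢x = from-yes (all? λ x → ¬? ((x +₃ 1F) ≟ x))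

x-1≢x : ∀ x → x +₃ -₃ 1F ≢ x
x-1≢x = from-yes (all? λ x → ¬? ((x +₃ -₃ 1F) ≟ x))

#-slice : ∀ {m} (f : VecSet (suc m)) c →
          (∀ x → x ≢ c → ¬ ∃ (_∈ᵛ slice f x)) → # f ≡ # (slice f c)
#-slice f c rest = begin
  # f
    ≡⟨ #-split f c 1F (λ ()) ⟩
  # (slice f c) + (# (slice f (c +₃ 1F)) + # (slice f (c +₃ -₃ 1F)))
    ≡⟨ cong₂ (λ k l → # (slice f c) + (k + l)) (empty (x+1≢x c)) (empty (x-1≢x c)) ⟩
  # (slice f c) + 0
    ≡⟨ ℕ.+-identityʳ _ ⟩
  # (slice f c) ∎
  where
  open ≡-Reasoning
  empty : ∀ {x} → x ≢ c → # (slice f x) ≡ 0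
  empty x≢c = #-empty λ v p → rest _ x≢c (v , p)

#-subsingleton : ∀ {m} {f : VecSet m} e → (∀ v → v ∈ᵛ f → v ≡ e) → # f ≤ 1
#-subsingleton {zero} {f} _ _ with f []
... | true  = ℕ.≤-refl
... | false = z≤n
#-subsingleton {suc m} {f} (x ∷ e) only = subst (_≤ 1)
  (sym (#-slice f x λ y y≢x (v , p) → y≢x (∷-injectiveˡ (only (y ∷ v) p))))
  (#-subsingleton e (λ v p → ∷-injectiveʳ (only (x ∷ v) p)))

_∖_ : ∀ {m} → VecSet m → Vec F m → VecSet m
(f ∖ v) w = if does (≡-dec _≟_ w v) then false else f w

#-remove : ∀ {m} {f : VecSet m} {v} → v ∈ᵛ f → suc (# (f ∖ v)) ≡ # f
#-remove {f = f} {[]} v∈f = sym (cong ⟦_⟧ v∈f)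
#-remove {f = f} {0F ∷ v} v∈f =
  cong (_+ (# (slice f 1F) + # (slice f 2F))) (#-remove {f = slice f 0F} v∈f)
#-remove {f = f} {1F ∷ v} v∈f = trans (sym (ℕ.+-suc (# (slice f 0F)) _))
  (cong (λ k → # (slice f 0F) + (k + # (slice f 2F))) (#-remove {f = slice f 1F} v∈f))
#-remove {f = f} {2F ∷ v} v∈f = trans (sym (ℕ.+-suc (# (slice f 0F)) _))
  (cong (# (slice f 0F) +_) (trans (sym (ℕ.+-suc (# (slice f 1F)) _))
    (cong (# (slice f 1F) +_) (#-remove {f = slice f 2F} v∈f))))

injection⇒≤# : ∀ {m k} {f : VecSet m} (g : Fin k → Vec F m) →
               (∀ {i j} → g i ≡ g j → i ≡ j) → (∀ i → g i ∈ᵛ f) → k ≤ # f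
injection⇒≤# {k = zero}  g inj g∈f = z≤n
injection⇒≤# {k = suc k} {f} g inj g∈f = subst (suc k ≤_) (#-remove {f = f} (g∈f zero))
  (s≤s (injection⇒≤# (g ∘ suc) (suc-injective ∘ inj) g∈f∖))
  where
  g∈f∖ : ∀ i → g (suc i) ∈ᵛ (f ∖ g zero)
  g∈f∖ i = trans (cong (if_then false else f (g (suc i)))
    (dec-false (≡-dec _≟_ (g (suc i)) (g zero)) (λ e → contradiction (inj e) λ ()))) (g∈f (suc i))

-- A vector of f whose first entry is that of d plus s uses up the one agreement
-- allowed, so it has the tail of d; if it occurs, then every vector of f with
-- the same first entry as d is equal to d.
#-anchored : ∀ {m} s → s ≢ 0F → (f : VecSet m) (d : Vec F m) →
             (∀ a → a ∈ᵛ f → occ s (d ⊖ a) ≤ 0) →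
             (∀ a → a ∈ᵛ f → occ s (a ⊖ d) ≤ 1) →
             (∀ a b → a ∈ᵛ f → b ∈ᵛ f → occ s (a ⊕ b ⊕ d) ≤ 1) →
             # f ≤ 2
#-anchored {zero} s s≢0 f [] h₀ h₁ h₂ with f []
... | true  = s≤s z≤n
... | false = z≤n
#-anchored {suc m} s s≢0 f (h ∷ e) h₀ h₁ h₂ =
  -- The first entries h, h + s and h - s exhaust GF(3) because `s` is nonzero.
  subst (_≤ 2) (sym (#-split f h s s≢0)) bound
  where
  open ≤-Reasoning
  low high base : VecSet m
  base = slice f h
  high = slice f (h +₃ s)
  low  = slice f (h +₃ -₃ s)

  h-[h-s] : ∀ h s → h +₃ -₃ (h +₃ -₃ s) ≡ s
  h-[h-s] = from-yes (all? λ h → all? λ s → (h +₃ -₃ (h +₃ -₃ s)) ≟ s)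
  [h+s]-h : ∀ h s → h +₃ s +₃ -₃ h ≡ s
  [h+s]-h = from-yes (all? λ h → all? λ s → (h +₃ s +₃ -₃ h) ≟ s)
  h+[h+s]+h : ∀ h s → h +₃ (h +₃ s) +₃ h ≡ s
  h+[h+s]+h = from-yes (all? λ h → all? λ s → (h +₃ (h +₃ s) +₃ h) ≟ s)

  -- For a vector in `low`, the difference of `d` and this vector starts with `s`, but no agreement
  -- is allowed there.
  low-empty : # low ≡ 0
  low-empty = #-empty λ a p → occ-here-≰0 (e ⊖ a) (h-[h-s] h s) (h₀ _ p)

  high⇒≡e : ∀ a → a ∈ᵛ high → a ≡ e
  high⇒≡e a p = occ-⊖-≤0⇒≡ s s≢0 a e
    (occ-here-≤ (a ⊖ e) ([h+s]-h h s) (h₁ _ p))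
    (occ-tail-≤ s (h +₃ -₃ (h +₃ s)) (e ⊖ a) (h₀ _ p))

  e∈high⇒base≡e : e ∈ᵛ high → ∀ a → a ∈ᵛ base → a ≡ e
  e∈high⇒base≡e q a p = occ-⊖-≤0⇒≡ s s≢0 a e
    -- The sum of h ∷ a, (h + s) ∷ e and `d` starts with 3h + s = s and has tail a + 2e = a - e.
    (subst (λ v → occ s v ≤ 0) (⊕-⊕ a e)
      (occ-here-≤ (a ⊕ e ⊕ e) (h+[h+s]+h h s) (h₂ _ _ p q)))
    (occ-tail-≤ s (h +₃ -₃ h) (e ⊖ a) (h₀ _ p))

  bound : # base + (# high + # low) ≤ 2
  bound with high e in eq
  ... | true  = ℕ.+-mono-≤ (#-subsingleton e (e∈high⇒base≡e eq))
    (ℕ.+-mono-≤ (#-subsingleton e high⇒≡e) (ℕ.≤-reflexive low-empty))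
  ... | false = begin
    # base + (# high + # low)
      ≡⟨ cong₂ (λ k l → # base + (k + l)) high-empty low-empty ⟩
    # base + 0
      ≡⟨ ℕ.+-identityʳ _ ⟩
    # base
      ≤⟨ #-anchored s s≢0 base e
           (λ a p → occ-tail-≤ s (h +₃ -₃ h) (e ⊖ a) (h₀ _ p))
           (λ a p → occ-tail-≤ s (h +₃ -₃ h) (a ⊖ e) (h₁ _ p))
           (λ a b p q → occ-tail-≤ s (h +₃ h +₃ h) (a ⊕ b ⊕ e) (h₂ _ _ p q)) ⟩
    2 ∎
    where
    high-empty : # high ≡ 0
    high-empty = #-empty λ a p →
      contradiction (trans (sym eq) (subst (_∈ᵛ high) (high⇒≡e a p) p)) λ ()

-- Differences and sums of three cancel a further coordinate that equals 1 on all the vectors, as 1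
-- - 1 = 1 + 1 + 1 = 0. That coordinate will be the one at b₀.
record AgreementBounds (k l : ℕ) {m} (f : VecSet m) : Set where
  field
    diff : ∀ s → s ≢ 0F → ∀ v w → v ∈ᵛ f → w ∈ᵛ f → occ s (v ⊖ w) ≤ k
    sum₃ : ∀ s → s ≢ 0F → ∀ v w x → v ∈ᵛ f → w ∈ᵛ f → x ∈ᵛ f → occ s (v ⊕ w ⊕ x) ≤ l

bounds-slice : ∀ {k l m} {f : VecSet (suc m)} → AgreementBounds k l f → ∀ c → AgreementBounds k l (slice f c)
bounds-slice B c = record
  { diff = λ s s≢0 v w p q → occ-tail-≤ s (c +₃ -₃ c) (v ⊖ w) (diff s s≢0 _ _ p q)
  ; sum₃ = λ s s≢0 v w x p q r → occ-tail-≤ s (c +₃ c +₃ c) (v ⊕ w ⊕ x) (sum₃ s s≢0 _ _ _ p q r)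
  }
  where open AgreementBounds B

-- A vector `d` of another slice serves as anchor. With s = h - c, both d - a and a + b + d start
-- with `s`, the latter because 2c + h = h - c. Their tails have one agreement fewer, which leaves
-- the bounds 0 and 1.
tight-slice≤2 : ∀ {m} {f : VecSet (suc m)} → AgreementBounds 1 2 f →
                ∀ {h} → ∃ (_∈ᵛ slice f h) → ∀ {c} → c ≢ h → # (slice f c) ≤ 2
tight-slice≤2 {f = f} B {h} (d , d∈) {c} c≢h =
  #-anchored s s≢0 (slice f c) d
    (λ a p → occ-here-≤ (d ⊖ a) refl (diff s s≢0 _ _ d∈ p))
    (λ a p → occ-tail-≤ s (c +₃ -₃ h) (a ⊖ d) (diff s s≢0 _ _ p d∈))
    (λ a b p q → occ-here-≤ (a ⊕ b ⊕ d) (c+c+h c h) (sum₃ s s≢0 _ _ _ p q d∈))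
  where
  open AgreementBounds B
  s : F
  s = h +₃ -₃ c
  diff≢0 : ∀ c h → c ≢ h → h +₃ -₃ c ≢ 0F
  diff≢0 = from-yes (all? λ c → all? λ h → ¬? (c ≟ h) →-dec ¬? ((h +₃ -₃ c) ≟ 0F))
  s≢0 : s ≢ 0F
  s≢0 = diff≢0 c h c≢h
  c+c+h : ∀ c h → c +₃ c +₃ h ≡ h +₃ -₃ c
  c+c+h = from-yes (all? λ c → all? λ h → (c +₃ c +₃ h) ≟ (h +₃ -₃ c))

two-slices : ∀ {m} {f : VecSet (suc m)} → AgreementBounds 1 2 f →
             ∀ {c h} → c ≢ h → ∃ (_∈ᵛ slice f c) → ∃ (_∈ᵛ slice f h) → # f ≤ 6
two-slices {f = f} B {c} {h} c≢h p q =
  ℕ.+-mono-≤ (each 0F) (ℕ.+-mono-≤ (each 1F) (each 2F))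
  where
  each : ∀ x → # (slice f x) ≤ 2
  -- Every slice differs from one of the two nonempty slices, which supplies its anchor.
  each x with x ≟ h
  ... | yes refl = tight-slice≤2 B p (c≢h ∘ sym)
  ... | no  x≢h  = tight-slice≤2 B q x≢h

tight≤6 : ∀ {m} (f : VecSet m) → AgreementBounds 1 2 f → # f ≤ 6
tight≤6 {zero} f B with f []
... | true  = s≤s z≤n
... | false = z≤n
tight≤6 {suc m} f B
  with nonempty? (slice f 0F) | nonempty? (slice f 1F) | nonempty? (slice f 2F)
... | yes p | yes q | _     = two-slices B (λ ()) p q
... | yes p | no  _ | yes r = two-slices B (λ ()) p r
... | no  _ | yes q | yes r = two-slices B (λ ()) q r
... | yes _ | no  q | no  r = subst (_≤ 6)
  (sym (#-slice f 0F λ { 0F x≢c → contradiction refl x≢c ; 1F _ → q ; 2F _ → r }))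
  (tight≤6 (slice f 0F) (bounds-slice B 0F))
... | no  p | yes _ | no  r = subst (_≤ 6)
  (sym (#-slice f 1F λ { 1F x≢c → contradiction refl x≢c ; 0F _ → p ; 2F _ → r }))
  (tight≤6 (slice f 1F) (bounds-slice B 1F))
... | no  p | no  q | _     = subst (_≤ 6)
  (sym (#-slice f 2F λ { 2F x≢c → contradiction refl x≢c ; 0F _ → p ; 1F _ → q }))
  (tight≤6 (slice f 2F) (bounds-slice B 2F))

-- Deleting a coordinate: the image and the vectors with several preimages.

shadow repeated : ∀ {m} → VecSet (suc m) → VecSet m
shadow   f v = f (0F ∷ v) ∨ (f (1F ∷ v) ∨ f (2F ∷ v))
repeated f v = (f (0F ∷ v) ∧ (f (1F ∷ v) ∨ f (2F ∷ v))) ∨ (f (1F ∷ v) ∧ f (2F ∷ v))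

shadow⁻ : ∀ {m} {f : VecSet (suc m)} {v} → v ∈ᵛ shadow f → ∃ λ x → (x ∷ v) ∈ᵛ f
shadow⁻ {f = f} {v} p with f (0F ∷ v) in e₀ | f (1F ∷ v) in e₁ | f (2F ∷ v) in e₂
... | true  | _     | _    = 0F , e₀
... | false | true  | _    = 1F , e₁
... | false | false | true = 2F , e₂

repeated⁻ : ∀ {m} {f : VecSet (suc m)} {v} → v ∈ᵛ repeated f →
            ∃ λ x → ∃ λ y → x ≢ y × (x ∷ v) ∈ᵛ f × (y ∷ v) ∈ᵛ f
repeated⁻ {f = f} {v} p with f (0F ∷ v) in e₀ | f (1F ∷ v) in e₁ | f (2F ∷ v) in e₂
... | true  | true  | _    = 0F , 1F , (λ ()) , e₀ , e₁
... | true  | false | true = 0F , 2F , (λ ()) , e₀ , e₂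
... | false | true  | true = 1F , 2F , (λ ()) , e₁ , e₂

#-fibres : ∀ {m} (f : VecSet (suc m)) → # f ≤ # (shadow f) + (# (repeated f) + # (repeated f))
#-fibres f = begin
  # f
    ≡⟨ cong (# (slice f 0F) +_) (∑-distrib-+ (⟦_⟧ ∘ slice f 1F) (⟦_⟧ ∘ slice f 2F)) ⟨
  # (slice f 0F) + ∑ (λ v → ⟦ f (1F ∷ v) ⟧ + ⟦ f (2F ∷ v) ⟧)
    ≡⟨ ∑-distrib-+ (⟦_⟧ ∘ slice f 0F) (λ v → ⟦ f (1F ∷ v) ⟧ + ⟦ f (2F ∷ v) ⟧) ⟨
  ∑ (λ v → ⟦ f (0F ∷ v) ⟧ + (⟦ f (1F ∷ v) ⟧ + ⟦ f (2F ∷ v) ⟧))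
    ≤⟨ ∑-mono (λ v → pointwise (f (0F ∷ v)) (f (1F ∷ v)) (f (2F ∷ v))) ⟩
  ∑ (λ v → ⟦ shadow f v ⟧ + (⟦ repeated f v ⟧ + ⟦ repeated f v ⟧))
    ≡⟨ ∑-distrib-+ (⟦_⟧ ∘ shadow f) (λ v → ⟦ repeated f v ⟧ + ⟦ repeated f v ⟧) ⟩
  # (shadow f) + ∑ (λ v → ⟦ repeated f v ⟧ + ⟦ repeated f v ⟧)
    ≡⟨ cong (# (shadow f) +_) (∑-distrib-+ (⟦_⟧ ∘ repeated f) (⟦_⟧ ∘ repeated f)) ⟩
  # (shadow f) + (# (repeated f) + # (repeated f)) ∎
  where
  open ≤-Reasoning
  -- A fibre has at most three elements: one is paid for by `shadow`, and up to two more by the two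
  -- copies of `repeated`.
  pointwise : ∀ a b c → ⟦ a ⟧ + (⟦ b ⟧ + ⟦ c ⟧) ≤
    ⟦ a ∨ (b ∨ c) ⟧ + (⟦ (a ∧ (b ∨ c)) ∨ (b ∧ c) ⟧ + ⟦ (a ∧ (b ∨ c)) ∨ (b ∧ c) ⟧)
  pointwise true  true  true  = ℕ.≤-refl
  pointwise true  true  false = ℕ.n≤1+n 2
  pointwise true  false true  = ℕ.n≤1+n 2
  pointwise true  false false = ℕ.≤-refl
  pointwise false true  true  = ℕ.n≤1+n 2
  pointwise false true  false = ℕ.≤-refl
  pointwise false false true  = ℕ.≤-refl
  pointwise false false false = ℕ.≤-refl

shadow-bounds : ∀ {k l m} {f : VecSet (suc m)} → AgreementBounds k l f → AgreementBounds k l (shadow f)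
shadow-bounds {f = f} B = record
  { diff = λ s s≢0 v w p q →
      let x , p′ = shadow⁻ {f = f} p ; y , q′ = shadow⁻ {f = f} q
      in occ-tail-≤ s (x +₃ -₃ y) (v ⊖ w) (diff s s≢0 _ _ p′ q′)
  ; sum₃ = λ s s≢0 v w u p q r →
      let x , p′ = shadow⁻ {f = f} p ; y , q′ = shadow⁻ {f = f} q ; z , r′ = shadow⁻ {f = f} r
      in occ-tail-≤ s (x +₃ y +₃ z) (v ⊕ w ⊕ u) (sum₃ s s≢0 _ _ _ p′ q′ r′)
  }
  where open AgreementBounds B

pairs-meet : ∀ (a a′ u u′ : F) → a ≢ a′ → u ≢ u′ → (u ≡ a ⊎ u ≡ a′) ⊎ (u′ ≡ a ⊎ u′ ≡ a′)
pairs-meet = from-yes (all? λ (a : F) → all? λ (a′ : F) → all? λ (u : F) → all? λ (u′ : F) →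
  ¬? (a ≟ a′) →-dec ¬? (u ≟ u′) →-dec
  (((u ≟ a) ⊎-dec (u ≟ a′)) ⊎-dec ((u′ ≟ a) ⊎-dec (u′ ≟ a′))))

-- An injective `φ` maps the second pair to a pair, and two pairs in a set of three elements meet.
pairs-solve : ∀ (φ : F → F) → (∀ {y y′} → φ y ≡ φ y′ → y ≡ y′) → ∀ {a a′ b b′} → a ≢ a′ → b ≢ b′ →
              ∃ λ x → ∃ λ y → (x ≡ a ⊎ x ≡ a′) × (y ≡ b ⊎ y ≡ b′) × x ≡ φ y
pairs-solve φ φ-inj {a} {a′} {b} {b′} a≢a′ b≢b′ =
  [ (λ p → φ b , b , p , inj₁ refl , refl)
  , (λ p → φ b′ , b′ , p , inj₂ refl , refl)
  ]′ (pairs-meet a a′ (φ b) (φ b′) a≢a′ (b≢b′ ∘ φ-inj))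

pairs-difference : ∀ s {a a′ b b′} → a ≢ a′ → b ≢ b′ →
  ∃ λ x → ∃ λ y → (x ≡ a ⊎ x ≡ a′) × (y ≡ b ⊎ y ≡ b′) × x +₃ -₃ y ≡ s
pairs-difference s a≢a′ b≢b′ =
  let x , y , p , q , eq = pairs-solve (s +₃_) (cancel s _ _) a≢a′ b≢b′
  in x , y , p , q , trans (cong (_+₃ -₃ y) eq) (s+y-y s y)
  where
  cancel : ∀ s y y′ → s +₃ y ≡ s +₃ y′ → y ≡ y′
  cancel = from-yes (all? λ s → all? λ y → all? λ y′ → ((s +₃ y) ≟ (s +₃ y′)) →-dec (y ≟ y′))
  s+y-y : ∀ s y → s +₃ y +₃ -₃ y ≡ s
  s+y-y = from-yes (all? λ s → all? λ y → (s +₃ y +₃ -₃ y) ≟ s)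

pairs-sum : ∀ s c {a a′ b b′} → a ≢ a′ → b ≢ b′ →
  ∃ λ x → ∃ λ y → (x ≡ a ⊎ x ≡ a′) × (y ≡ b ⊎ y ≡ b′) × x +₃ y +₃ c ≡ s
pairs-sum s c a≢a′ b≢b′ =
  let x , y , p , q , eq = pairs-solve (λ y → s +₃ -₃ (y +₃ c)) (cancel s c _ _) a≢a′ b≢b′
  in x , y , p , q , trans (cong (λ z → z +₃ y +₃ c) eq) (s-[y+c]+y+c s c y)
  where
  cancel : ∀ s c y y′ → s +₃ -₃ (y +₃ c) ≡ s +₃ -₃ (y′ +₃ c) → y ≡ y′
  cancel = from-yes (all? λ s → all? λ c → all? λ y → all? λ y′ →
    ((s +₃ -₃ (y +₃ c)) ≟ (s +₃ -₃ (y′ +₃ c))) →-dec (y ≟ y′))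
  s-[y+c]+y+c : ∀ s c y → s +₃ -₃ (y +₃ c) +₃ y +₃ c ≡ s
  s-[y+c]+y+c = from-yes (all? λ s → all? λ c → all? λ y → (s +₃ -₃ (y +₃ c) +₃ y +₃ c) ≟ s)

-- Two-element subsets A, B of GF(3) satisfy A + B = GF(3), so on repeated
-- vectors the deleted coordinate can be chosen to contribute an agreement.
repeated-bounds : ∀ {k l m} {f : VecSet (suc m)} → AgreementBounds (suc k) (suc l) f →
                  AgreementBounds k l (repeated f)
repeated-bounds {k} {l} {m} {f} B = record { diff = diff′ ; sum₃ = sum₃′ }
  where
  open AgreementBounds B
  Repeats : Vec F m → Set
  Repeats v = ∃ λ x → ∃ λ y → x ≢ y × (x ∷ v) ∈ᵛ f × (y ∷ v) ∈ᵛ f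
  pick : ∀ {x a b v} → (a ∷ v) ∈ᵛ f → (b ∷ v) ∈ᵛ f → x ≡ a ⊎ x ≡ b → (x ∷ v) ∈ᵛ f
  pick p _ (inj₁ refl) = p
  pick _ q (inj₂ refl) = q

  diff′ : ∀ s → s ≢ 0F → ∀ v w → v ∈ᵛ repeated f → w ∈ᵛ repeated f → occ s (v ⊖ w) ≤ k
  diff′ s s≢0 v w p q = choose (repeated⁻ {f = f} p) (repeated⁻ {f = f} q)
    where
    conclude : ∀ {x y} → (x ∷ v) ∈ᵛ f → (y ∷ w) ∈ᵛ f → x +₃ -₃ y ≡ s → occ s (v ⊖ w) ≤ k
    conclude {x} {y} x∈ y∈ eq = occ-here-≤ {x = x +₃ -₃ y} (v ⊖ w) eq (diff s s≢0 (x ∷ v) (y ∷ w) x∈ y∈)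
    choose : Repeats v → Repeats w → occ s (v ⊖ w) ≤ k
    choose (_ , _ , a≢a′ , p₁ , p₂) (_ , _ , b≢b′ , q₁ , q₂) =
      let _ , _ , x∈ , y∈ , eq = pairs-difference s a≢a′ b≢b′
      in conclude (pick p₁ p₂ x∈) (pick q₁ q₂ y∈) eq

  sum₃′ : ∀ s → s ≢ 0F → ∀ v w u → v ∈ᵛ repeated f → w ∈ᵛ repeated f → u ∈ᵛ repeated f →
          occ s (v ⊕ w ⊕ u) ≤ l
  sum₃′ s s≢0 v w u p q r = choose (repeated⁻ {f = f} p) (repeated⁻ {f = f} q) (repeated⁻ {f = f} r)
    where
    conclude : ∀ {x y z} → (x ∷ v) ∈ᵛ f → (y ∷ w) ∈ᵛ f → (z ∷ u) ∈ᵛ f → x +₃ y +₃ z ≡ s →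
               occ s (v ⊕ w ⊕ u) ≤ l
    conclude {x} {y} {z} x∈ y∈ z∈ eq =
      occ-here-≤ {x = x +₃ y +₃ z} (v ⊕ w ⊕ u) eq (sum₃ s s≢0 (x ∷ v) (y ∷ w) (z ∷ u) x∈ y∈ z∈)
    choose : Repeats v → Repeats w → Repeats u → occ s (v ⊕ w ⊕ u) ≤ l
    -- The third vector contributes a fixed entry `z`; the choices for the other two reach every
    -- value, in particular s - z.
    choose (_ , _ , a≢a′ , p₁ , p₂) (_ , _ , b≢b′ , q₁ , q₂) (z , _ , _ , r₁ , _) =
      let _ , _ , x∈ , y∈ , eq = pairs-sum s z a≢a′ b≢b′
      in conclude (pick p₁ p₂ x∈) (pick q₁ q₂ y∈) r₁ eq

bounds⇒≤12m+1 : ∀ {m} (f : VecSet m) → AgreementBounds 2 3 f → # f ≤ suc (m * 12)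
bounds⇒≤12m+1 {zero} f B with f []
... | true  = ℕ.≤-refl
... | false = z≤n
bounds⇒≤12m+1 {suc m} f B = begin
  # f
    ≤⟨ #-fibres f ⟩
  # (shadow f) + (# (repeated f) + # (repeated f))
    ≤⟨ ℕ.+-mono-≤ (bounds⇒≤12m+1 (shadow f) (shadow-bounds B)) (ℕ.+-mono-≤ rep rep) ⟩
  suc (m * 12) + 12
    ≡⟨ cong suc (ℕ.+-comm (m * 12) 12) ⟩
  suc (suc m * 12) ∎
  where
  open ≤-Reasoning
  rep : # (repeated f) ≤ 6
  rep = tight≤6 (repeated f) (repeated-bounds B)

-- The linear case: entries of single vectors and of sums of two.

𝟎 : ∀ {m} → Vec F m
𝟎 = Vec.replicate _ 0F

occ-𝟎⊖ : ∀ {m} s (v : Vec F m) → occ (-₃ s) (𝟎 ⊖ v) ≡ occ s v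
occ-𝟎⊖ s  []       = refl
occ-𝟎⊖ 0F (0F ∷ v) = cong suc (occ-𝟎⊖ 0F v)
occ-𝟎⊖ 0F (1F ∷ v) = occ-𝟎⊖ 0F v
occ-𝟎⊖ 0F (2F ∷ v) = occ-𝟎⊖ 0F v
occ-𝟎⊖ 1F (0F ∷ v) = occ-𝟎⊖ 1F v
occ-𝟎⊖ 1F (1F ∷ v) = cong suc (occ-𝟎⊖ 1F v)
occ-𝟎⊖ 1F (2F ∷ v) = occ-𝟎⊖ 1F v
occ-𝟎⊖ 2F (0F ∷ v) = occ-𝟎⊖ 2F v
occ-𝟎⊖ 2F (1F ∷ v) = occ-𝟎⊖ 2F v
occ-𝟎⊖ 2F (2F ∷ v) = cong suc (occ-𝟎⊖ 2F v)

⊖𝟎 : ∀ {m} (v : Vec F m) → v ⊖ 𝟎 ≡ v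
⊖𝟎 []      = refl
⊖𝟎 (x ∷ v) = cong₂ _∷_ (+-identityʳ x) (⊖𝟎 v)

⊕𝟎 : ∀ {m} (v : Vec F m) → v ⊕ 𝟎 ≡ v
⊕𝟎 []      = refl
⊕𝟎 (x ∷ v) = cong₂ _∷_ (+-identityʳ x) (⊕𝟎 v)

-- The zero vector is the anchor. A vector starting with c ≠ 0 spends its one allowed entry `c`
-- there, and a sum of two such vectors spends an entry 2c = -c. Hence each of the two nonzero
-- slices has at most 2 vectors, and each coordinate costs at most 4.
linear≤4m+1 : ∀ {m} (f : VecSet m) →
              (∀ s → s ≢ 0F → ∀ v → v ∈ᵛ f → occ s v ≤ 1) →
              (∀ s → s ≢ 0F → ∀ v w → v ∈ᵛ f → w ∈ᵛ f → occ s (v ⊕ w) ≤ 2) →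
              # f ≤ suc (m * 4)
linear≤4m+1 {zero} f h₁ h₂ with f []
... | true  = ℕ.≤-refl
... | false = z≤n
linear≤4m+1 {suc m} f h₁ h₂ = begin
  # f
    ≤⟨ ℕ.+-mono-≤ (linear≤4m+1 (slice f 0F)
         (λ s s≢0 v p → occ-tail-≤ s 0F v (h₁ s s≢0 _ p))
         (λ s s≢0 v w p q → occ-tail-≤ s 0F (v ⊕ w) (h₂ s s≢0 _ _ p q)))
       (ℕ.+-mono-≤ (nonzero 1F 2F (λ ()) (λ ()) refl (occ-𝟎⊖ 1F))
                    (nonzero 2F 1F (λ ()) (λ ()) refl (occ-𝟎⊖ 2F))) ⟩
  suc (m * 4) + 4
    ≡⟨ cong suc (ℕ.+-comm (m * 4) 4) ⟩
  suc (suc m * 4) ∎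
  where
  open ≤-Reasoning
  nonzero : ∀ c s → c ≢ 0F → s ≢ 0F → c +₃ c ≡ s →
            (∀ (v : Vec F m) → occ s (𝟎 ⊖ v) ≡ occ c v) → # (slice f c) ≤ 2
  nonzero c s c≢0 s≢0 c+c≡s occ-neg = #-anchored s s≢0 (slice f c) 𝟎
    (λ a p → subst (_≤ 0) (sym (occ-neg a)) (occ-here-≤ a refl (h₁ c c≢0 _ p)))
    (λ a p → subst (λ v → occ s v ≤ 1) (sym (⊖𝟎 a)) (occ-tail-≤ s c a (h₁ s s≢0 _ p)))
    (λ a b p q → subst (λ v → occ s v ≤ 1) (sym (⊕𝟎 (a ⊕ b)))
      (occ-here-≤ (a ⊕ b) c+c≡s (h₂ s s≢0 _ _ p q)))

-- Supports and weights of coefficient vectors.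

module R = CommutativeRing
  (HeytingCommutativeRing.commutativeRing (HeytingField.heytingCommutativeRing GF3.heytingField))
open import Algebra.Properties.Monoid.Sum R.+-monoid using (sum; sum-cong-≗)
open import Algebra.Properties.CommutativeMonoid.Sum R.+-commutativeMonoid using () renaming (∑-distrib-+ to sum-distrib-+)
open import Algebra.Properties.Semiring.Sum R.semiring using (*-distribˡ-sum)

support : ∀ {n} → (Fin n → F) → Subset n
support a = tabulate (λ j → not (does (a j ≟ 0F)))

weight : ∀ {n} → (Fin n → F) → ℕ
weight a = ∣ support a ∣

∈-tabulate⁺ : ∀ {n} {p : Fin n → Bool} {j} → p j ≡ true → j ∈ tabulate p
∈-tabulate⁺ {p = p} {j} e = lookup⇒[]= j (tabulate p) (trans (lookup∘tabulate p j) e)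

∈-tabulate⁻ : ∀ {n} {p : Fin n → Bool} {j} → j ∈ tabulate p → p j ≡ true
∈-tabulate⁻ {p = p} {j} j∈ = trans (sym (lookup∘tabulate p j)) ([]=⇒lookup j∈)

∈-support⁺ : ∀ {n} (a : Fin n → F) {j} → a j ≢ 0F → j ∈ support a
∈-support⁺ a {j} a≢0 = ∈-tabulate⁺ (cong not (dec-false (a j ≟ 0F) a≢0))

∈-support⁻ : ∀ {n} (a : Fin n → F) {j} → j ∈ support a → a j ≢ 0F
∈-support⁻ a {j} j∈ a≡0 =
  contradiction (trans (sym (∈-tabulate⁻ j∈)) (cong not (dec-true (a j ≟ 0F) a≡0))) λ ()

∉-support⁻ : ∀ {n} (a : Fin n → F) {j} → j ∉ support a → a j ≡ 0F
∉-support⁻ a {j} j∉ = decidable-stable (a j ≟ 0F) (j∉ ∘ ∈-support⁺ a)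

∣∷∣ : ∀ {n} b (p : Subset n) → ∣ b ∷ p ∣ ≡ ⟦ b ⟧ + ∣ p ∣
∣∷∣ true  p = refl
∣∷∣ false p = refl

-- This reduces inequalities between sums of cardinalities to a check at one coordinate, which over
-- GF(3) is finite.
∣∣-mono-pointwise : ∀ {n} (p q r s : Fin n → Bool) →
  (∀ j → ⟦ p j ⟧ + ⟦ q j ⟧ ≤ ⟦ r j ⟧ + ⟦ s j ⟧) →
  ∣ tabulate p ∣ + ∣ tabulate q ∣ ≤ ∣ tabulate r ∣ + ∣ tabulate s ∣
∣∣-mono-pointwise {zero}  p q r s le = z≤n
∣∣-mono-pointwise {suc n} p q r s le = begin
  ∣ tabulate p ∣ + ∣ tabulate q ∣
    ≡⟨ expand p q ⟩
  (⟦ p zero ⟧ + ⟦ q zero ⟧) + (∣ tabulate (p ∘ suc) ∣ + ∣ tabulate (q ∘ suc) ∣)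
    ≤⟨ ℕ.+-mono-≤ (le zero) (∣∣-mono-pointwise (p ∘ suc) (q ∘ suc) (r ∘ suc) (s ∘ suc) (le ∘ suc)) ⟩
  (⟦ r zero ⟧ + ⟦ s zero ⟧) + (∣ tabulate (r ∘ suc) ∣ + ∣ tabulate (s ∘ suc) ∣)
    ≡⟨ expand r s ⟨
  ∣ tabulate r ∣ + ∣ tabulate s ∣ ∎
  where
  open ≤-Reasoning
  expand : ∀ (p q : Fin (suc n) → Bool) → ∣ tabulate p ∣ + ∣ tabulate q ∣ ≡
    (⟦ p zero ⟧ + ⟦ q zero ⟧) + (∣ tabulate (p ∘ suc) ∣ + ∣ tabulate (q ∘ suc) ∣)
  expand p q = trans
    (cong₂ _+_ (∣∷∣ (p zero) (tabulate (p ∘ suc))) (∣∷∣ (q zero) (tabulate (q ∘ suc))))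
    (ℕ+.interchange ⟦ p zero ⟧ (∣ tabulate (p ∘ suc) ∣) ⟦ q zero ⟧ (∣ tabulate (q ∘ suc) ∣))

∣p∣≤1+∣p-x∣ : ∀ {n} (p : Subset n) x → ∣ p ∣ ≤ suc ∣ p ∖ˢ x ∣
∣p∣≤1+∣p-x∣ (inside  ∷ p) zero    = s≤s (ℕ.≤-reflexive (cong ∣_∣ (sym (p─⊥≡p p))))
∣p∣≤1+∣p-x∣ (outside ∷ p) zero    = ℕ.≤-trans (ℕ.≤-reflexive (cong ∣_∣ (sym (p─⊥≡p p)))) (ℕ.n≤1+n _)
∣p∣≤1+∣p-x∣ (inside  ∷ p) (suc x) = s≤s (∣p∣≤1+∣p-x∣ p x)
∣p∣≤1+∣p-x∣ (outside ∷ p) (suc x) = ∣p∣≤1+∣p-x∣ p x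

weight-+ : ∀ {n} (a b : Fin n → F) → weight (λ j → a j +₃ b j) ≤ weight a + weight b
weight-+ {n} a b = ℕ.≤-trans (ℕ.m≤m+n _ _)
  -- The constant `false` is an empty set that pads the left side to two terms.
  (∣∣-mono-pointwise (λ j → nz (a j +₃ b j)) (λ _ → false) (λ j → nz (a j)) (λ j → nz (b j))
    (λ j → pointwise (a j) (b j)))
  where
  nz : F → Bool
  nz x = not (does (x ≟ 0F))
  pointwise : ∀ x y → ⟦ nz (x +₃ y) ⟧ + 0 ≤ ⟦ nz x ⟧ + ⟦ nz y ⟧
  pointwise = from-yes (all? λ x → all? λ y → (⟦ nz (x +₃ y) ⟧ + 0) ≤? (⟦ nz x ⟧ + ⟦ nz y ⟧))

weight-mono : ∀ {n} {a b : Fin n → F} → (∀ j → b j ≡ 0F → a j ≡ 0F) → weight a ≤ weight b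
weight-mono {a = a} {b} b≡0⇒a≡0 = p⊆q⇒∣p∣≤∣q∣ {p = support a} {q = support b}
  λ j∈ → ∈-support⁺ b (∈-support⁻ a j∈ ∘ b≡0⇒a≡0 _)

weight-neg : ∀ {n} (a : Fin n → F) → weight (λ j → -₃ a j) ≤ weight a
weight-neg a = weight-mono {a = λ j → -₃ a j} {b = a} λ j e → cong -₃_ e

δ : ∀ {n} → Fin n → Fin n → F
δ e j = if does (j ≟ e) then 1F else 0F

δ-≡ : ∀ {n} (e : Fin n) → δ e e ≡ 1F
δ-≡ e = cong (if_then 1F else 0F) (dec-true (e ≟ e) refl)

δ-≢ : ∀ {n} {e j : Fin n} → j ≢ e → δ e j ≡ 0F
δ-≢ {e = e} {j} j≢e = cong (if_then 1F else 0F) (dec-false (j ≟ e) j≢e)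

weight-δ : ∀ {n} c (e : Fin n) → weight (λ j → c *₃ δ e j) ≤ 1
weight-δ c e = subst (weight (λ j → c *₃ δ e j) ≤_) (∣⁅x⁆∣≡1 e)
  (p⊆q⇒∣p∣≤∣q∣ {p = support (λ j → c *₃ δ e j)} λ {j} j∈ →
    decidable-stable (j ∈? ⁅ e ⁆) λ j∉ →
      ∈-support⁻ (λ j → c *₃ δ e j) j∈ (trans (cong (c *₃_) (δ-≢ (x∉⁅y⁆⇒x≢y j∉))) (*-zeroʳ c)))
-- The extra 1 accounts for `t`, whose image may lie outside `f`.
punctured-injection⇒≤# : ∀ {n m} {f : VecSet m} (t : Fin n) (g : Fin n → Vec F m) →
  (∀ {i j} → g i ≡ g j → i ≡ j) → (∀ i → i ≢ t → g i ∈ᵛ f) → n ≤ suc (# f)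
punctured-injection⇒≤# {suc n} t g inj g∈f = s≤s (injection⇒≤# (g ∘ punchIn t)
  (punchIn-injective t _ _ ∘ inj) (λ i → g∈f (punchIn t i) (punchInᵢ≢i t i)))

-- Restriction of coefficient vectors to a subset.

project : ∀ {n} (S : Subset n) → (Fin n → F) → Vec F ∣ S ∣
project []            g = []
project (inside  ∷ S) g = g zero ∷ project S (g ∘ suc)
project (outside ∷ S) g = project S (g ∘ suc)

project-cong : ∀ {n} (S : Subset n) {g h : Fin n → F} → g ≗ h → project S g ≡ project S h
project-cong []            g≗h = refl
project-cong (inside  ∷ S) g≗h = cong₂ _∷_ (g≗h zero) (project-cong S (g≗h ∘ suc))
project-cong (outside ∷ S) g≗h = project-cong S (g≗h ∘ suc)

project-⊕ : ∀ {n} (S : Subset n) (g h : Fin n → F) →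
            project S (λ j → g j +₃ h j) ≡ project S g ⊕ project S h
project-⊕ []            g h = refl
project-⊕ (inside  ∷ S) g h = cong (_ ∷_) (project-⊕ S (g ∘ suc) (h ∘ suc))
project-⊕ (outside ∷ S) g h = project-⊕ S (g ∘ suc) (h ∘ suc)

project-⊖ : ∀ {n} (S : Subset n) (g h : Fin n → F) →
            project S (λ j → g j +₃ -₃ h j) ≡ project S g ⊖ project S h
project-⊖ []            g h = refl
project-⊖ (inside  ∷ S) g h = cong (_ ∷_) (project-⊖ S (g ∘ suc) (h ∘ suc))
project-⊖ (outside ∷ S) g h = project-⊖ S (g ∘ suc) (h ∘ suc)

project-injective : ∀ {n} (S : Subset n) {g h : Fin n → F} → project S g ≡ project S h →
                    ∀ {j} → j ∈ S → g j ≡ h j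
project-injective (inside  ∷ S) e here        = ∷-injectiveˡ e
project-injective (inside  ∷ S) e (there j∈S) = project-injective S (∷-injectiveʳ e) j∈S
project-injective (outside ∷ S) e (there j∈S) = project-injective S e j∈S

occ-project : ∀ {n} s (S : Subset n) (g : Fin n → F) →
              occ s (project S g) ≤ ∣ tabulate (λ j → does (g j ≟ s)) ∣
occ-project s []            g = z≤n
occ-project s (outside ∷ S) g = ℕ.≤-trans (occ-project s S (g ∘ suc))
  (∣p∣≤∣x∷p∣ (does (g zero ≟ s)) (tabulate (λ j → does (g (suc j) ≟ s))))
occ-project s (inside  ∷ S) g with does (g zero ≟ s)
... | true  = s≤s (occ-project s S (g ∘ suc))
... | false = occ-project s S (g ∘ suc)

-- Relations among columns and a relation of minimum weight through an element.

module Relations {m n : ℕ} (A : Fin m → Fin n → F) where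

  ev : (Fin n → F) → Fin m → F
  ev a i = sum (λ j → a j *₃ A i j)

  ev-cong : ∀ {a b} → a ≗ b → ev a ≗ ev b
  ev-cong a≗b i = sum-cong-≗ (λ j → cong (_*₃ A i j) (a≗b j))

  ev-+ : ∀ a b → ev (λ j → a j +₃ b j) ≗ λ i → ev a i +₃ ev b i
  ev-+ a b i = trans (sum-cong-≗ (λ j → R.distribʳ (A i j) (a j) (b j)))
    (sum-distrib-+ (λ j → a j *₃ A i j) (λ j → b j *₃ A i j))

  ev-* : ∀ c a → ev (λ j → c *₃ a j) ≗ λ i → c *₃ ev a i
  ev-* c a i = trans (sum-cong-≗ (λ j → R.*-assoc c (a j) (A i j)))
    (sym (*-distribˡ-sum c (λ j → a j *₃ A i j)))

  ev-neg : ∀ a → ev (λ j → -₃ a j) ≗ λ i → -₃ ev a i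
  ev-neg a i = trans (ev-cong (λ j → -x≡2x (a j)) i) (trans (ev-* 2F a i) (sym (-x≡2x (ev a i))))
    where
    -x≡2x : ∀ x → -₃ x ≡ 2F *₃ x
    -x≡2x = from-yes (all? λ x → (-₃ x) ≟ (2F *₃ x))

  Relation : (Fin n → F) → Set
  Relation a = ∀ i → ev a i ≡ 0F

  ev-+* : ∀ a c b → ev (λ j → a j +₃ c *₃ b j) ≗ λ i → ev a i +₃ c *₃ ev b i
  ev-+* a c b i = trans (ev-+ a (λ j → c *₃ b j) i) (cong (ev a i +₃_) (ev-* c b i))

  relation-+* : ∀ {a b} c → Relation a → Relation b → Relation (λ j → a j +₃ c *₃ b j)
  relation-+* {a} {b} c ra rb i = trans (ev-+* a c b i)
    (trans (cong₂ (λ x y → x +₃ c *₃ y) (ra i) (rb i)) (x+y*0≡x 0F c))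

  module Combinations
    (a : Fin n → F) (t : Fin n) (a-relation : Relation a) (aₜ≢0 : a t ≢ 0F)
    (a-minimal : ∀ c → Relation c → c t ≢ 0F → weight a ≤ weight c)
    (b₀ : Fin n)
    where

    S : Subset n
    S = support a ∖ˢ t

    -- u stands for Σⱼ uⱼ xⱼ, where xⱼ is column j of A: this vector is a
    -- combination of at most k columns other than that of t.
    record Combination (k : ℕ) (u : Fin n → F) : Set where
      field
        word        : Fin n → F
        word-weight : weight word ≤ k
        word-t      : word t ≡ 0F
        word-ev     : ev word ≗ ev u
        u-t         : u t ≡ 0F
        u-outside   : ∀ j → j ∉ S → j ≢ b₀ → u j ≡ 0F

    open Combination

    combine-+ : ∀ {k l u w} → Combination k u → Combination l w →
                Combination (k + l) (λ j → u j +₃ w j)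
    combine-+ {u = u} {w} C D = record
      { word        = λ j → word C j +₃ word D j
      ; word-weight = ℕ.≤-trans (weight-+ (word C) (word D)) (ℕ.+-mono-≤ (word-weight C) (word-weight D))
      ; word-t      = cong₂ _+₃_ (word-t C) (word-t D)
      ; word-ev     = λ i → trans (ev-+ (word C) (word D) i)
          (trans (cong₂ _+₃_ (word-ev C i) (word-ev D i)) (sym (ev-+ u w i)))
      ; u-t         = cong₂ _+₃_ (u-t C) (u-t D)
      ; u-outside   = λ j j∉S j≢b₀ → cong₂ _+₃_ (u-outside C j j∉S j≢b₀) (u-outside D j j∉S j≢b₀)
      }

    combine-- : ∀ {k l u w} → Combination k u → Combination l w →
                Combination (k + l) (λ j → u j +₃ -₃ w j)
    combine-- {u = u} {w} C D = combine-+ C (record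
      { word        = λ j → -₃ word D j
      ; word-weight = ℕ.≤-trans (weight-neg (word D)) (word-weight D)
      ; word-t      = cong -₃_ (word-t D)
      ; word-ev     = λ i → trans (ev-neg (word D) i) (trans (cong -₃_ (word-ev D i)) (sym (ev-neg w i)))
      ; u-t         = cong -₃_ (u-t D)
      ; u-outside   = λ j j∉S j≢b₀ → cong -₃_ (u-outside D j j∉S j≢b₀)
      })

    -- With g the word of `u`, the relation c = a + s(g - u) has the same entry at `t` as `a`, so it
    -- weighs at least as much. Where a u = s, one has s u = a because nonzero elements square to 1,
    -- so c is nonzero there only if g is. These cancellations must therefore be paid for by the
    -- weight of g.
    agreement : ∀ {k u} → Combination k u → u b₀ ≡ 0F → ∀ s → s ≢ 0F →
                ∣ tabulate (λ j → does ((a j *₃ u j) ≟ s)) ∣ ≤ k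
    agreement {k} {u} C ub₀≡0 s s≢0 = ℕ.+-cancelˡ-≤ (weight a) _ _ (begin
      weight a + agree
        ≤⟨ ℕ.+-monoˡ-≤ agree (a-minimal c c-relation cₜ≢0) ⟩
      weight c + agree
        ≤⟨ ∣∣-mono-pointwise (λ j → nz (c j)) (λ j → does ((a j *₃ u j) ≟ s)) (λ j → nz (g j)) (λ j → nz (a j))
             (λ j → pointwise s (a j) (g j) (u j) s≢0 (u-supported j)) ⟩
      weight g + weight a
        ≤⟨ ℕ.+-monoˡ-≤ (weight a) (word-weight C) ⟩
      k + weight a
        ≡⟨ ℕ.+-comm k (weight a) ⟩
      weight a + k ∎)
      where
      open ≤-Reasoning
      g : Fin n → F
      g = word C
      c : Fin n → F
      c j = (a j +₃ s *₃ g j) +₃ (-₃ s) *₃ u j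
      agree : ℕ
      agree = ∣ tabulate (λ j → does ((a j *₃ u j) ≟ s)) ∣
      nz : F → Bool
      nz x = not (does (x ≟ 0F))
      c-relation : Relation c
      c-relation i = trans (ev-+* (λ j → a j +₃ s *₃ g j) (-₃ s) u i)
        (trans (cong (_+₃ (-₃ s) *₃ ev u i)
          (trans (ev-+* a s g i) (cong₂ (λ x y → x +₃ s *₃ y) (a-relation i) (word-ev C i))))
        (cancels s (ev u i)))
        where
        cancels : ∀ s x → (0F +₃ s *₃ x) +₃ (-₃ s) *₃ x ≡ 0F
        cancels = from-yes (all? λ s → all? λ x → ((0F +₃ s *₃ x) +₃ (-₃ s) *₃ x) ≟ 0F)
      cₜ≢0 : c t ≢ 0F
      cₜ≢0 cₜ≡0 = aₜ≢0 (trans (sym (unchanged s (a t)))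
        (trans (sym (cong₂ (λ x y → (a t +₃ s *₃ x) +₃ (-₃ s) *₃ y) (word-t C) (u-t C))) cₜ≡0))
        where
        unchanged : ∀ s x → (x +₃ s *₃ 0F) +₃ (-₃ s) *₃ 0F ≡ x
        unchanged = from-yes (all? λ s → all? λ x → ((x +₃ s *₃ 0F) +₃ (-₃ s) *₃ 0F) ≟ x)
      -- As `u` vanishes at `b₀`, it lives on `S`, hence on the support of `a`.
      u-supported : ∀ j → a j ≡ 0F → u j ≡ 0F
      u-supported j aj≡0 with j ≟ b₀
      ... | yes refl = ub₀≡0
      ... | no j≢b₀  = u-outside C j (λ j∈S → ∈-support⁻ a (p─q⊆p _ _ j∈S) aj≡0) j≢b₀
      pointwise : ∀ s x g u → s ≢ 0F → (x ≡ 0F → u ≡ 0F) →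
        ⟦ nz ((x +₃ s *₃ g) +₃ (-₃ s) *₃ u) ⟧ + ⟦ does ((x *₃ u) ≟ s) ⟧ ≤ ⟦ nz g ⟧ + ⟦ nz x ⟧
      pointwise = from-yes (all? λ s → all? λ x → all? λ g → all? λ u →
        ¬? (s ≟ 0F) →-dec ((x ≟ 0F) →-dec (u ≟ 0F)) →-dec
        (⟦ nz ((x +₃ s *₃ g) +₃ (-₃ s) *₃ u) ⟧ + ⟦ does ((x *₃ u) ≟ s) ⟧) ≤? (⟦ nz g ⟧ + ⟦ nz x ⟧))

    -- Multiplying by `a` turns agreement of `u` with a multiple of `a` on `S` into the occurrence
    -- of one fixed value `s`.
    coordinates : (Fin n → F) → Vec F ∣ S ∣
    coordinates u = project S (λ j → a j *₃ u j)

    occ-coordinates : ∀ {k u} → Combination k u → u b₀ ≡ 0F → ∀ s → s ≢ 0F → occ s (coordinates u) ≤ k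
    occ-coordinates C ub₀≡0 s s≢0 = ℕ.≤-trans (occ-project s S _) (agreement C ub₀≡0 s s≢0)

    -- Counting the elements by their expansions in a basis.

    module Bound
      (simple : ∀ e f c d → e ≢ f → ev (λ j → c *₃ δ e j) ≗ ev (λ j → d *₃ δ f j) → c ≡ 0F)
      (v : Fin n → Fin n → F)
      (v-ev : ∀ e → ev (δ e) ≗ ev (v e))
      (v-t : ∀ e → v e t ≡ 0F)
      (v-outside : ∀ e j → j ∉ S → j ≢ b₀ → v e j ≡ 0F)
      where

      -- Scaling makes the coefficient of b₀ equal to 0 or 1.
      κ : F → F
      κ 0F = 1F
      κ 1F = 1F
      κ 2F = 2F

      κ≢0 : ∀ x → κ x ≢ 0F
      κ≢0 = from-yes (all? λ x → ¬? (κ x ≟ 0F))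

      y : Fin n → Fin n → F
      y e j = κ (v e b₀) *₃ v e j

      ev-y : ∀ e → ev (λ j → κ (v e b₀) *₃ δ e j) ≗ ev (y e)
      ev-y e i = trans (ev-* (κ (v e b₀)) (δ e) i)
        (trans (cong (κ (v e b₀) *₃_) (v-ev e i)) (sym (ev-* (κ (v e b₀)) (v e) i)))

      y-combination : ∀ e → e ≢ t → Combination 1 (y e)
      y-combination e e≢t = record
        { word        = λ j → κ (v e b₀) *₃ δ e j
        ; word-weight = weight-δ (κ (v e b₀)) e
        ; word-t      = trans (cong (κ (v e b₀) *₃_) (δ-≢ (e≢t ∘ sym))) (*-zeroʳ (κ (v e b₀)))
        ; word-ev     = ev-y e
        ; u-t         = trans (cong (κ (v e b₀) *₃_) (v-t e)) (*-zeroʳ (κ (v e b₀)))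
        ; u-outside   = λ j j∉S j≢b₀ → trans (cong (κ (v e b₀) *₃_) (v-outside e j j∉S j≢b₀)) (*-zeroʳ (κ (v e b₀)))
        }

      point : Fin n → Vec F (suc ∣ S ∣)
      point e = y e b₀ ∷ coordinates (y e)

      -- The entries of `a` on `S` are invertible, so a point determines the whole scaled expansion.
      -- Equal expansions would make nonzero multiples of two distinct columns equal, contrary to
      -- `simple`.
      point-injective : ∀ {e f} → point e ≡ point f → e ≡ f
      point-injective {e} {f} eq = decidable-stable (e ≟ f) λ e≢f →
        κ≢0 (v e b₀) (simple e f (κ (v e b₀)) (κ (v f b₀)) e≢f λ i →
          trans (ev-y e i) (trans (ev-cong y≗ i) (sym (ev-y f i))))
        where
        cancel : ∀ a x y → a ≢ 0F → a *₃ x ≡ a *₃ y → x ≡ y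
        cancel = from-yes (all? λ a → all? λ x → all? λ y →
          ¬? (a ≟ 0F) →-dec ((a *₃ x) ≟ (a *₃ y)) →-dec (x ≟ y))
        y≗ : y e ≗ y f
        y≗ j with j ∈? S | j ≟ b₀
        ... | yes j∈S | _        = cancel (a j) (y e j) (y f j)
          (∈-support⁻ a (p─q⊆p _ _ j∈S)) (project-injective S (∷-injectiveʳ eq) j∈S)
        ... | no _    | yes refl = ∷-injectiveˡ eq
        ... | no j∉S  | no j≢b₀  = trans (zero-at e) (sym (zero-at f))
          where
          zero-at : ∀ e → y e j ≡ 0F
          zero-at e = trans (cong (κ (v e b₀) *₃_) (v-outside e j j∉S j≢b₀)) (*-zeroʳ (κ (v e b₀)))

      point? : ∀ w → Dec (∃ λ e → e ≢ t × point e ≡ w)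
      point? w = any? λ e → ¬? (e ≟ t) ×-dec ≡-dec _≟_ (point e) w

      points : VecSet (suc ∣ S ∣)
      points w = does (point? w)

      points⁻ : ∀ {w} → w ∈ᵛ points → ∃ λ e → e ≢ t × point e ≡ w
      points⁻ {w} eq with point? w
      ... | yes p = p

      n≤1+#points : n ≤ suc (# points)
      n≤1+#points = punctured-injection⇒≤# {f = points} t point point-injective
        (λ e e≢t → dec-true (point? _) (e , e≢t , refl))

      slice⁻ : ∀ {x w} → w ∈ᵛ slice points x →
               ∃ λ u → Combination 1 u × u b₀ ≡ x × coordinates u ≡ w
      slice⁻ w∈ with points⁻ w∈
      ... | e , e≢t , refl = y e , y-combination e e≢t , refl , refl

      coordinates-⊕ : ∀ u w → coordinates (λ j → u j +₃ w j) ≡ coordinates u ⊕ coordinates w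
      coordinates-⊕ u w = trans (project-cong S λ j → R.distribˡ (a j) (u j) (w j))
        (project-⊕ S (λ j → a j *₃ u j) (λ j → a j *₃ w j))

      coordinates-⊖ : ∀ u w → coordinates (λ j → u j +₃ -₃ w j) ≡ coordinates u ⊖ coordinates w
      coordinates-⊖ u w = trans (project-cong S λ j → distrib-⊖ (a j) (u j) (w j))
        (project-⊖ S (λ j → a j *₃ u j) (λ j → a j *₃ w j))
        where
        distrib-⊖ : ∀ a x y → a *₃ (x +₃ -₃ y) ≡ a *₃ x +₃ -₃ (a *₃ y)
        distrib-⊖ = from-yes (all? λ a → all? λ x → all? λ y → (a *₃ (x +₃ -₃ y)) ≟ (a *₃ x +₃ -₃ (a *₃ y)))

      slice₀-bound : # (slice points 0F) ≤ suc (∣ S ∣ * 4)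
      slice₀-bound = linear≤4m+1 (slice points 0F) single double
        where
        single : ∀ s → s ≢ 0F → ∀ v → v ∈ᵛ slice points 0F → occ s v ≤ 1
        single s s≢0 v v∈ with slice⁻ v∈
        ... | u , C , u₀ , refl = occ-coordinates C u₀ s s≢0
        double : ∀ s → s ≢ 0F → ∀ v w → v ∈ᵛ slice points 0F → w ∈ᵛ slice points 0F → occ s (v ⊕ w) ≤ 2
        double s s≢0 v w v∈ w∈ with slice⁻ v∈ | slice⁻ w∈
        ... | u₁ , C₁ , e₁ , refl | u₂ , C₂ , e₂ , refl =
          subst (λ x → occ s x ≤ 2) (coordinates-⊕ u₁ u₂)
            (occ-coordinates (combine-+ C₁ C₂) (cong₂ _+₃_ e₁ e₂) s s≢0)

      -- The coefficient 1 at `b₀` cancels in these combinations, and each bound is the number of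
      -- columns combined.
      slice₁-bounds : AgreementBounds 2 3 (slice points 1F)
      slice₁-bounds = record { diff = diff′ ; sum₃ = sum₃′ }
        where
        diff′ : ∀ s → s ≢ 0F → ∀ v w → v ∈ᵛ slice points 1F → w ∈ᵛ slice points 1F → occ s (v ⊖ w) ≤ 2
        diff′ s s≢0 v w v∈ w∈ with slice⁻ v∈ | slice⁻ w∈
        ... | u₁ , C₁ , e₁ , refl | u₂ , C₂ , e₂ , refl =
          subst (λ x → occ s x ≤ 2) (coordinates-⊖ u₁ u₂)
            (occ-coordinates (combine-- C₁ C₂) (cong₂ (λ x y → x +₃ -₃ y) e₁ e₂) s s≢0)
        sum₃′ : ∀ s → s ≢ 0F → ∀ v w x → v ∈ᵛ slice points 1F → w ∈ᵛ slice points 1F →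
                x ∈ᵛ slice points 1F → occ s (v ⊕ w ⊕ x) ≤ 3
        sum₃′ s s≢0 v w x v∈ w∈ x∈ with slice⁻ v∈ | slice⁻ w∈ | slice⁻ x∈
        ... | u₁ , C₁ , e₁ , refl | u₂ , C₂ , e₂ , refl | u₃ , C₃ , e₃ , refl =
          subst (λ x → occ s x ≤ 3)
            (trans (coordinates-⊕ (λ j → u₁ j +₃ u₂ j) u₃) (cong (_⊕ coordinates u₃) (coordinates-⊕ u₁ u₂)))
            (occ-coordinates (combine-+ (combine-+ C₁ C₂) C₃) (cong₂ _+₃_ (cong₂ _+₃_ e₁ e₂) e₃) s s≢0)

      slice₂-empty : # (slice points 2F) ≡ 0
      slice₂-empty = #-empty {f = slice points 2F} λ w → absurd {w}
        where
        κx*x≢2 : ∀ x → κ x *₃ x ≢ 2F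
        κx*x≢2 = from-yes (all? λ x → ¬? ((κ x *₃ x) ≟ 2F))
        absurd : ∀ {w} → ¬ w ∈ᵛ slice points 2F
        absurd w∈ with points⁻ w∈
        ... | e , _ , eq = κx*x≢2 (v e b₀) (∷-injectiveˡ eq)

      bound : n ≤ suc (suc (∣ S ∣ * 4) + suc (∣ S ∣ * 12))
      bound = ℕ.≤-trans n≤1+#points (s≤s (ℕ.+-mono-≤ slice₀-bound
        (subst (_≤ _) (sym (trans (cong (# (slice points 1F) +_) slice₂-empty) (ℕ.+-identityʳ _)))
          (bounds⇒≤12m+1 (slice points 1F) slice₁-bounds))))

      linear-bound : (∀ e → v e b₀ ≡ 0F) → n ≤ suc (suc (∣ S ∣ * 4))
      linear-bound v-b₀ = ℕ.≤-trans n≤1+#points (s≤s (subst (_≤ _)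
        (sym (trans (cong (# (slice points 0F) +_) (cong₂ _+_ slice₁-empty slice₂-empty)) (ℕ.+-identityʳ _)))
        slice₀-bound))
        where
        absurd : ∀ {w} → ¬ w ∈ᵛ slice points 1F
        absurd w∈ with points⁻ w∈
        ... | e , _ , eq = contradiction
          (trans (sym (∷-injectiveˡ eq)) (trans (cong (κ (v e b₀) *₃_) (v-b₀ e)) (*-zeroʳ (κ (v e b₀))))) λ ()
        slice₁-empty : # (slice points 1F) ≡ 0
        slice₁-empty = #-empty {f = slice points 1F} λ w → absurd {w}

-- Rank, bases and small independent sets.

∈-subsets : ∀ {n} (p : Subset n) → p ∈ˡ subsets n
∈-subsets []            = hereˡ refl
∈-subsets (outside ∷ p) = ∈-++⁺ˡ (∈-map⁺ (outside ∷_) (∈-subsets p))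
∈-subsets (inside  ∷ p) = ∈-++⁺ʳ (map (outside ∷_) (subsets _)) (∈-map⁺ (inside ∷_) (∈-subsets p))

x∉p-x : ∀ {n} {p : Subset n} x → x ∉ p ∖ˢ x
x∉p-x {p = _ ∷ p} (suc x) (there x∈) = x∉p-x {p = p} x x∈

module _ {n : ℕ} (M : Matroid n) where
  open Matroid M

  indep⇒∣∣≤rank : ∀ {I} → Indep I → ∣ I ∣ ≤ rank M
  indep⇒∣∣≤rank {I} ind = All.lookup (xs≤max 0 (map ∣_∣ (filter indep? (subsets n))))
    (∈-map⁺ ∣_∣ (∈-filter⁺ indep? (∈-subsets I) ind))

  rank-attained : ∃ λ I → Indep I × ∣ I ∣ ≡ rank M
  rank-attained with argmax-sel id 0 (map ∣_∣ (filter indep? (subsets n)))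
  -- The default value 0 of the maximum is attained by the empty set.
  ... | inj₁ eq = ⊥ , ⊥-indep , trans (∣⊥∣≡0 n) (sym eq)
  ... | inj₂ r∈ with ∈-map⁻ ∣_∣ r∈
  ...   | I , I∈ , eq = I , proj₂ (∈-filter⁻ indep? {xs = subsets n} I∈) , sym eq

  rank≤∣basis∣ : ∀ {B} → IsBasis M B → rank M ≤ ∣ B ∣
  rank≤∣basis∣ {B} (indB , maximal) = ℕ.≮⇒≥ λ B<rank →
    let I , indI , ∣I∣≡rank     = rank-attained
        e , _ , e∉B , indB∪e = augment indB indI (subst (∣ B ∣ <_) (sym ∣I∣≡rank) B<rank)
    in e∉B (subst (e ∈_) (maximal indB∪e (p⊆p∪q ⁅ e ⁆)) (q⊆p∪q B ⁅ e ⁆ (x∈⁅x⁆ e)))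

  module _ (simple : Simple M) where

    singleton-indep : ∀ e → Indep ⁅ e ⁆
    singleton-indep e = decidable-stable (indep? ⁅ e ⁆) λ dep →
      proj₁ simple e (dep , λ { (D⊆e , x , x∈e , x∉D) → hereditary
        (λ {y} y∈D → contradiction
          (subst (_∈ _) (trans (x∈⁅y⁆⇒x≡y e (D⊆e y∈D)) (sym (x∈⁅y⁆⇒x≡y e x∈e))) y∈D) x∉D)
        ⊥-indep })

    -- A proper subset of the pair misses one element and so lies in the singleton of the other; a
    -- dependent pair would thus be a circuit.
    pair-indep : ∀ {e f} → e ≢ f → Indep (⁅ e ⁆ ∪ ⁅ f ⁆)
    pair-indep {e} {f} e≢f = decidable-stable (indep? (⁅ e ⁆ ∪ ⁅ f ⁆)) λ dep →
      proj₂ simple e f (e≢f , dep , proper)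
      where
      proper : ∀ {D} → D ⊂ ⁅ e ⁆ ∪ ⁅ f ⁆ → Indep D
      proper {D} (D⊆ , x , x∈ , x∉D) with x∈p∪q⁻ ⁅ e ⁆ ⁅ f ⁆ x∈
      ... | inj₁ x∈e = hereditary (λ {y} y∈D →
        [ (λ y∈e → contradiction (subst (_∈ D) (trans (x∈⁅y⁆⇒x≡y e y∈e) (sym (x∈⁅y⁆⇒x≡y e x∈e))) y∈D) x∉D)
        , id ]′ (x∈p∪q⁻ ⁅ e ⁆ ⁅ f ⁆ (D⊆ y∈D))) (singleton-indep f)
      ... | inj₂ x∈f = hereditary (λ {y} y∈D →
        [ id
        , (λ y∈f → contradiction (subst (_∈ D) (trans (x∈⁅y⁆⇒x≡y f y∈f) (sym (x∈⁅y⁆⇒x≡y f x∈f))) y∈D) x∉D)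
        ]′ (x∈p∪q⁻ ⁅ e ⁆ ⁅ f ⁆ (D⊆ y∈D))) (singleton-indep e)

  -- Represented matroids: relations, circuits and expansions.

  module Represented {m : ℕ} (A : Fin m → Fin n → F)
    (represents : ∀ X → Indep X ⇔ ColumnsIndependent GF3.heytingField A X) where
    open Relations A

    indep⁻ : ∀ {X a} → Indep X → (∀ j → j ∉ X → a j ≡ 0F) → Relation a → ∀ j → a j ≡ 0F
    indep⁻ {X} {a} ind = Equivalence.to (represents X) ind a

    indep⁺ : ∀ {X} → (∀ a → (∀ j → j ∉ X → a j ≡ 0F) → Relation a → ∀ j → a j ≡ 0F) → Indep X
    indep⁺ {X} = Equivalence.from (represents X)

    -- Nonzero elements of GF(3) are their own inverses, so `a i *₃ b i` is the quotient by which
    -- `b` must be multiplied to clear the entry of `a` at `i`. The support does not grow, since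
    -- that of `b` lies in that of `a`.
    eliminate : ∀ {a b i t} → Relation a → Relation b → b i ≢ 0F → b t ≡ 0F →
                (∀ j → a j ≡ 0F → b j ≡ 0F) →
                ∃ λ c → Relation c × c t ≡ a t × weight c < weight a
    eliminate {a} {b} {i} {t} ra rb bᵢ≢0 bₜ≡0 b≪a =
      c , relation-+* {a} {b} (-₃ (a i *₃ b i)) ra rb ,
      trans (cong (λ x → a t +₃ -₃ (a i *₃ b i) *₃ x) bₜ≡0) (x+y*0≡x (a t) (-₃ (a i *₃ b i))) ,
      p⊂q⇒∣p∣<∣q∣ (sub , i , ∈-support⁺ a (bᵢ≢0 ∘ b≪a i) , λ i∈ → ∈-support⁻ c i∈ (killed (a i) (b i) bᵢ≢0))
      where
      c : Fin n → F
      c j = a j +₃ -₃ (a i *₃ b i) *₃ b j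
      killed : ∀ x y → y ≢ 0F → x +₃ -₃ (x *₃ y) *₃ y ≡ 0F
      killed = from-yes (all? λ x → all? λ y → ¬? (y ≟ 0F) →-dec ((x +₃ -₃ (x *₃ y) *₃ y) ≟ 0F))
      sub : support c ⊆ support a
      sub {j} j∈ = ∈-support⁺ a λ aj≡0 → ∈-support⁻ c j∈
        (trans (cong₂ (λ x y → x +₃ -₃ (a i *₃ b i) *₃ y) aj≡0 (b≪a j aj≡0)) (x+y*0≡x 0F (-₃ (a i *₃ b i))))

    -- A nonzero relation `b` on a proper subset of the support contradicts minimality: directly if
    -- `b` is nonzero at `t`, and otherwise by eliminating an entry of `a` with it.
    minimal⇒circuit : ∀ {a t} → Relation a → a t ≢ 0F →
      (∀ c → Relation c → c t ≢ 0F → weight a ≤ weight c) → IsCircuit M (support a)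
    minimal⇒circuit {a} {t} ra aₜ≢0 min = dependent , proper
      where
      dependent : ¬ Indep (support a)
      dependent ind = aₜ≢0 (indep⁻ {a = a} ind (λ j → ∉-support⁻ a) ra t)
      proper : ∀ {D} → D ⊂ support a → Indep D
      proper {D} D⊂a = indep⁺ λ b b-off rb i → decidable-stable (b i ≟ 0F) (go b b-off rb i)
        where
        go : ∀ b → (∀ j → j ∉ D → b j ≡ 0F) → Relation b → ∀ i → ¬ b i ≢ 0F
        go b b-off rb i bᵢ≢0 with b t ≟ 0F
        ... | no bₜ≢0 = ℕ.<⇒≱ (p⊂q⇒∣p∣<∣q∣ (⊆-⊂-trans supp-b⊆D D⊂a)) (min b rb bₜ≢0)
          where
          supp-b⊆D : support b ⊆ D
          supp-b⊆D {j} j∈ = decidable-stable (j ∈? D) (∈-support⁻ b j∈ ∘ b-off j)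
        ... | yes bₜ≡0 with eliminate {a} {b} ra rb bᵢ≢0 bₜ≡0
                  (λ j aj≡0 → b-off j λ j∈D → ∈-support⁻ a (proj₁ D⊂a j∈D) aj≡0)
        ...   | c , rc , cₜ≡aₜ , c<a = ℕ.<⇒≱ c<a (min c rc (aₜ≢0 ∘ trans (sym cₜ≡aₜ)))

    -- Induction on the weight. If it were below the rank, the induction hypothesis would exclude
    -- lighter relations through `t`, so the support would be a circuit through `t`, to which
    -- looseness applies.
    loose⇒rank≤weight : ∀ {t} → IsLoose M t → ∀ a → Relation a → a t ≢ 0F → rank M ≤ weight a
    loose⇒rank≤weight {t} loose a = go a (<-wellFounded (weight a))
      where
      go : ∀ a → Acc _<_ (weight a) → Relation a → a t ≢ 0F → rank M ≤ weight a
      go a (acc rs) ra aₜ≢0 = decidable-stable (rank M ≤? weight a) λ ¬le → ¬le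
        (loose (minimal⇒circuit {a} ra aₜ≢0 λ c rc cₜ≢0 → ℕ.≮⇒≥ λ c<a →
            ¬le (ℕ.≤-trans (go c (rs c<a) rc cₜ≢0) (ℕ.<⇒≤ c<a)))
          (∈-support⁺ a aₜ≢0))

    Coordinates : Subset n → Fin n → Set
    Coordinates B e = ∃ λ v → (∀ j → j ∉ B → v j ≡ 0F) × ev (δ e) ≗ ev v

    -- A relation on B ∪ {e} with a nonzero entry at `e` can be solved for column `e`. Without an
    -- expansion, B ∪ {e} would therefore be independent and larger than the rank.
    coordinates-exist : ∀ {B} → Indep B → rank M ≤ ∣ B ∣ → ∀ e → ¬ ¬ Coordinates B e
    coordinates-exist {B} indB rank≤∣B∣ e none = ℕ.<⇒≱
      (ℕ.≤-<-trans rank≤∣B∣ (p⊂q⇒∣p∣<∣q∣ (p⊆p∪q ⁅ e ⁆ , e , q⊆p∪q B ⁅ e ⁆ (x∈⁅x⁆ e) , e∉B)))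
      (indep⇒∣∣≤rank indB∪e)
      where
      e∉B : e ∉ B
      e∉B e∈B = none (δ e , (λ j j∉B → δ-≢ {e = e} {j} λ { refl → j∉B e∈B }) , λ i → refl)
      outside-B∪e : ∀ {j} → j ∉ B → j ≢ e → j ∉ B ∪ ⁅ e ⁆
      outside-B∪e j∉B j≢e = [ j∉B , j≢e ∘ x∈⁅y⁆⇒x≡y e ]′ ∘ x∈p∪q⁻ B ⁅ e ⁆
      module _ (a : Fin n → F) (a-off : ∀ j → j ∉ B ∪ ⁅ e ⁆ → a j ≡ 0F) (ra : Relation a) where
        aₑ≡0 : a e ≡ 0F
        aₑ≡0 = decidable-stable (a e ≟ 0F) λ aₑ≢0 → none
          -- As `a e` squares to 1, this cancels the entry at `e`; adding a multiple of a relation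
          -- leaves the evaluation unchanged.
          ( (λ j → δ e j +₃ -₃ a e *₃ a j)
          , (λ j j∉B → v-off aₑ≢0 j∉B (j ≟ e))
          , (λ i → sym (trans (ev-+* (δ e) (-₃ a e) a i)
              (trans (cong (λ x → ev (δ e) i +₃ -₃ a e *₃ x) (ra i)) (x+y*0≡x (ev (δ e) i) (-₃ a e))))))
          where
          1-x*x : ∀ x → x ≢ 0F → 1F +₃ -₃ x *₃ x ≡ 0F
          1-x*x = from-yes (all? λ x → ¬? (x ≟ 0F) →-dec ((1F +₃ -₃ x *₃ x) ≟ 0F))
          v-off : a e ≢ 0F → ∀ {j} → j ∉ B → Dec (j ≡ e) → δ e j +₃ -₃ a e *₃ a j ≡ 0F
          v-off aₑ≢0 j∉B (yes refl) = trans (cong (_+₃ -₃ a e *₃ a e) (δ-≡ e)) (1-x*x (a e) aₑ≢0)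
          v-off aₑ≢0 {j} j∉B (no j≢e) = trans
            (cong₂ (λ x y → x +₃ -₃ a e *₃ y) (δ-≢ j≢e) (a-off j (outside-B∪e j∉B j≢e))) (x+y*0≡x 0F (-₃ a e))
        a-off-B : ∀ j → j ∉ B → a j ≡ 0F
        a-off-B j j∉B with j ≟ e
        ... | yes refl = aₑ≡0
        ... | no j≢e   = a-off j (outside-B∪e j∉B j≢e)
      indB∪e : Indep (B ∪ ⁅ e ⁆)
      indB∪e = indep⁺ λ a a-off ra → indep⁻ {B} indB (a-off-B a a-off ra) ra

    -- Double negation commutes with quantification over a finite set.
    all-coordinates : ∀ {B} → Indep B → rank M ≤ ∣ B ∣ → ¬ ¬ (∀ e → Coordinates B e)
    all-coordinates indB rank≤∣B∣ =
      sequence (RawMonad.rawApplicative ¬¬-Monad) (coordinates-exist indB rank≤∣B∣)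

    simple⇒scaled-distinct : Simple M → ∀ e f c d → e ≢ f →
      ev (λ j → c *₃ δ e j) ≗ ev (λ j → d *₃ δ f j) → c ≡ 0F
    simple⇒scaled-distinct simple e f c d e≢f eq = trans (sym at-e) (indep⁻ {a = a} (pair-indep simple e≢f) a-off ra e)
      where
      a : Fin n → F
      a j = c *₃ δ e j +₃ -₃ (d *₃ δ f j)
      c*1-d*0 : ∀ c d → c *₃ 1F +₃ -₃ (d *₃ 0F) ≡ c
      c*1-d*0 = from-yes (all? λ c → all? λ d → (c *₃ 1F +₃ -₃ (d *₃ 0F)) ≟ c)
      c*0-d*0 : ∀ c d → c *₃ 0F +₃ -₃ (d *₃ 0F) ≡ 0F
      c*0-d*0 = from-yes (all? λ c → all? λ d → (c *₃ 0F +₃ -₃ (d *₃ 0F)) ≟ 0F)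
      at-e : a e ≡ c
      at-e = trans (cong₂ (λ x y → c *₃ x +₃ -₃ (d *₃ y)) (δ-≡ e) (δ-≢ e≢f)) (c*1-d*0 c d)
      a-off : ∀ j → j ∉ ⁅ e ⁆ ∪ ⁅ f ⁆ → a j ≡ 0F
      a-off j j∉ = trans (cong₂ (λ x y → c *₃ x +₃ -₃ (d *₃ y))
        (δ-≢ {e = e} {j} λ { refl → j∉ (p⊆p∪q ⁅ f ⁆ (x∈⁅x⁆ e)) })
        (δ-≢ {e = f} {j} λ { refl → j∉ (q⊆p∪q ⁅ e ⁆ ⁅ f ⁆ (x∈⁅x⁆ f)) })) (c*0-d*0 c d)
      ra : Relation a
      ra i = trans (ev-+ (λ j → c *₃ δ e j) (λ j → -₃ (d *₃ δ f j)) i)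
        (trans (cong₂ _+₃_ (eq i) (ev-neg (λ j → d *₃ δ f j) i)) (x-x≡0 (ev (λ j → d *₃ δ f j) i)))

    -- The two cases for the minimum weight of a relation through t.

    module _ (simple : Simple M) {t : Fin n} (loose : IsLoose M t) where

      -- Looseness makes `a` minimal of weight exactly the rank. Thus `S`, a proper subset of a
      -- circuit, is independent and one element short of a basis; augmentation supplies `b₀`.
      bound-short : ∀ a → Relation a → a t ≢ 0F → weight a ≤ rank M →
        ¬ ¬ ∃ λ m → m < rank M × n ≤ suc (suc (m * 4) + suc (m * 12))
      bound-short a ra aₜ≢0 a≤rank none = go
        where
        minimal : ∀ c → Relation c → c t ≢ 0F → weight a ≤ weight c
        minimal c rc cₜ≢0 = ℕ.≤-trans a≤rank (loose⇒rank≤weight loose c rc cₜ≢0)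
        circuit : IsCircuit M (support a)
        circuit = minimal⇒circuit {a} ra aₜ≢0 minimal
        S : Subset n
        S = support a ∖ˢ t
        S⊂a : S ⊂ support a
        S⊂a = x∈p⇒p-x⊂p (∈-support⁺ a aₜ≢0)
        ∣S∣<rank : ∣ S ∣ < rank M
        ∣S∣<rank = ℕ.<-≤-trans (p⊂q⇒∣p∣<∣q∣ S⊂a) a≤rank
        go = let I , indI , ∣I∣≡rank = rank-attained
                 b₀ , _ , b₀∉S , indB = augment (proj₂ circuit S⊂a) indI (subst (∣ S ∣ <_) (sym ∣I∣≡rank) ∣S∣<rank)
             in extend b₀ b₀∉S indB
          where
          extend : ∀ b₀ → b₀ ∉ S → Indep (S ∪ ⁅ b₀ ⁆) → _
          extend b₀ b₀∉S indB = all-coordinates indB rank≤∣B∣ λ coords →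
            none (∣ S ∣ , ∣S∣<rank , Combinations.Bound.bound a t ra aₜ≢0 minimal b₀
              (simple⇒scaled-distinct simple) (proj₁ ∘ coords) (λ e → proj₂ (proj₂ (coords e)))
              (λ e → proj₁ (proj₂ (coords e)) t t∉B)
              (λ e j j∉S j≢b₀ → proj₁ (proj₂ (coords e)) j
                ([ j∉S , j≢b₀ ∘ x∈⁅y⁆⇒x≡y b₀ ]′ ∘ x∈p∪q⁻ S ⁅ b₀ ⁆)))
            where
            rank≤∣B∣ : rank M ≤ ∣ S ∪ ⁅ b₀ ⁆ ∣
            rank≤∣B∣ = begin
              rank M              ≤⟨ loose⇒rank≤weight loose a ra aₜ≢0 ⟩
              weight a            ≤⟨ ∣p∣≤1+∣p-x∣ (support a) t ⟩
              suc ∣ S ∣           ≤⟨ p⊂q⇒∣p∣<∣q∣ (p⊆p∪q ⁅ b₀ ⁆ , b₀ , q⊆p∪q S ⁅ b₀ ⁆ (x∈⁅x⁆ b₀) , b₀∉S) ⟩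
              ∣ S ∪ ⁅ b₀ ⁆ ∣      ∎
              where open ≤-Reasoning
            -- Otherwise the basis would contain the circuit `support a`.
            t∉B : t ∉ S ∪ ⁅ b₀ ⁆
            t∉B t∈B = proj₁ circuit (hereditary a⊆B indB)
              where
              a⊆B : support a ⊆ S ∪ ⁅ b₀ ⁆
              a⊆B {j} j∈ with j ≟ t
              ... | yes refl = t∈B
              ... | no j≢t   = p⊆p∪q ⁅ b₀ ⁆ (x∈p∧x≢y⇒x∈p-y j∈ j≢t)

      -- Since `t` is not a coloop, some basis `B` avoids it. The expansion of `t` in `B` gives a
      -- relation of weight more than the rank, so it uses all of `B`; then `S` is the basis, and
      -- the relation is minimal.
      bound-long : (∀ c → Relation c → c t ≢ 0F → rank M < weight c) → ¬ IsColoop M t →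
        ¬ ¬ ∃ λ m → m ≤ rank M × n ≤ suc (suc (m * 4))
      bound-long long ¬coloop none = ¬coloop λ {B} basis → decidable-stable (t ∈? B) (λ t∉B →
        all-coordinates (proj₁ basis) (rank≤∣basis∣ basis) (avoiding B basis t∉B))
        where
        avoiding : ∀ B → IsBasis M B → t ∉ B → ¬ (∀ e → Coordinates B e)
        avoiding B basis t∉B coords = none (∣ S ∣ , ∣S∣≤rank ,
          -- Here `t` takes the place of `b₀`: every expansion in `B` vanishes at `t`.
          Combinations.Bound.linear-bound a t ra aₜ≢0 minimal t
            (simple⇒scaled-distinct simple) v (λ e → proj₂ (proj₂ (coords e))) v-t
            (λ e j j∉S _ → proj₁ (proj₂ (coords e)) j (j∉S ∘ B⊆S)) v-t)
          where
          v : Fin n → Fin n → F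
          v e = proj₁ (coords e)
          v-t : ∀ e → v e t ≡ 0F
          v-t e = proj₁ (proj₂ (coords e)) t t∉B
          a : Fin n → F
          a j = δ t j +₃ -₃ v t j
          S : Subset n
          S = support a ∖ˢ t
          ra : Relation a
          ra i = trans (ev-+ (δ t) (λ j → -₃ v t j) i)
            (trans (cong₂ _+₃_ (proj₂ (proj₂ (coords t)) i) (ev-neg (v t) i)) (x-x≡0 (ev (v t) i)))
          aₜ≢0 : a t ≢ 0F
          aₜ≢0 aₜ≡0 = contradiction (trans (sym (cong₂ (λ x y → x +₃ -₃ y) (δ-≡ t) (v-t t))) aₜ≡0) λ ()
          S⊆B : S ⊆ B
          S⊆B {j} j∈S = decidable-stable (j ∈? B) λ j∉B → ∈-support⁻ a (p─q⊆p (support a) ⁅ t ⁆ j∈S)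
            (cong₂ (λ x y → x +₃ -₃ y) (δ-≢ {e = t} {j} λ { refl → x∉p-x t j∈S }) (proj₁ (proj₂ (coords t)) j j∉B))
          ∣S∣≤rank : ∣ S ∣ ≤ rank M
          ∣S∣≤rank = ℕ.≤-trans (p⊆q⇒∣p∣≤∣q∣ S⊆B) (indep⇒∣∣≤rank (proj₁ basis))
          minimal : ∀ c → Relation c → c t ≢ 0F → weight a ≤ weight c
          minimal c rc cₜ≢0 = ℕ.≤-trans (∣p∣≤1+∣p-x∣ (support a) t)
            (ℕ.≤-<-trans ∣S∣≤rank (long c rc cₜ≢0))
          B⊆S : B ⊆ S
          -- An element of `B` outside `S` would force the size of `S` below the rank, while the
          -- weight of `a`, at most one more than that size, exceeds the rank.
          B⊆S {j} j∈B = decidable-stable (j ∈? S) λ j∉S → ℕ.<⇒≱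
            (ℕ.<-≤-trans (p⊂q⇒∣p∣<∣q∣ ((λ {x} → S⊆B {x}) , j , j∈B , j∉S)) (indep⇒∣∣≤rank (proj₁ basis)))
            (s≤s⁻¹ (ℕ.≤-trans (long a ra aₜ≢0) (∣p∣≤1+∣p-x∣ (support a) t)))

      module _ (¬coloop : ¬ IsColoop M t) where

        -- The goal is decidable, so the doubly negated bounds may be used to refute its negation.
        -- Refuting the first case is what provides the hypothesis of the second.
        element-bound : ∀ {k} →
          (∀ m → m < rank M → suc (suc (m * 4) + suc (m * 12)) ≤ k) →
          (∀ m → m ≤ rank M → suc (suc (m * 4)) ≤ k) → n ≤ k
        element-bound {k} short long = decidable-stable (n ≤? k) λ n≰k →
          bound-long
            (λ c rc cₜ≢0 → ℕ.≰⇒> λ c≤rank → bound-short c rc cₜ≢0 c≤rank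
              λ { (m , m< , n≤) → n≰k (ℕ.≤-trans n≤ (short m m<)) })
            ¬coloop
            λ { (m , m≤ , n≤) → n≰k (ℕ.≤-trans n≤ (long m m≤)) }

-- Arithmetic of the final bounds.

≤-/2 : ∀ {n k} → n * 2 ≤ k → n ≤ k / 2
≤-/2 {n} {k} le = subst (_≤ k / 2) (m*n/n≡m n 2) (/-monoˡ-≤ 2 le)

theorem3p1 : (r : ℕ) → 5 ≤ r →
    (n : ℕ) (M : Matroid n) →
    Simple M → Ternary M → rank M ≡ r →
    (∃ λ t → IsLoose M t) →
    (∀ e → ¬ IsColoop M e) →
    (10 < r → n ≤ (41 * r ∸ 101) / 2) ×
    (r ≤ 10 → n ≤ (35 * r ∸ 35) / 2)
theorem3p1 (suc r) (s≤s 4≤r) n M simple (_ , A , represents) rank≡ (t , loose) ¬coloop =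
  (λ { (s≤s 10≤r) → bound (large 10≤r) }) , λ _ → bound (ℕ.≤-reflexive (sym (35*[1+r]∸35 r)))
  where
  open Represented M A represents
  open ≤-Reasoning

  -- After the pattern match the rank is r + 1, so both estimates are compared with 35r.
  35*[1+r]∸35 : ∀ r → 35 * suc r ∸ 35 ≡ 35 * r
  35*[1+r]∸35 r = trans (cong (_∸ 35) (ℕ.*-suc 35 r)) (ℕ.m+n∸m≡n 35 (35 * r))

  -- Since 101 = 41 + 60, the excess of 41(r + 1) - 101 over 35r is 6(r - 10).
  large : 10 ≤ r → 35 * r ≤ 41 * suc r ∸ 101
  large 10≤r = ℕ.m+n≤o⇒m≤o∸n (35 * r) (begin
    35 * r + (41 + 6 * 10)  ≤⟨ ℕ.+-monoʳ-≤ (35 * r) (ℕ.+-monoʳ-≤ 41 (ℕ.*-monoʳ-≤ 6 10≤r)) ⟩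
    35 * r + (41 + 6 * r)   ≡⟨ solve 1 (λ r → con 35 :* r :+ (con 41 :+ con 6 :* r) := con 41 :* (con 1 :+ r)) refl r ⟩
    41 * suc r              ∎)

  short : ∀ m → m < rank M → suc (suc (m * 4) + suc (m * 12)) * 2 ≤ 35 * r
  short m m<rank = begin
    suc (suc (m * 4) + suc (m * 12)) * 2
      ≡⟨ solve 1 (λ m → (con 1 :+ ((con 1 :+ m :* con 4) :+ (con 1 :+ m :* con 12))) :* con 2 :=
                        con 32 :* m :+ con 6) refl m ⟩
    32 * m + 6
      -- The constant 6 is absorbed by 3r, as r ≥ 4.
      ≤⟨ ℕ.+-mono-≤ (ℕ.*-monoʳ-≤ 32 m≤r) (ℕ.≤-trans (ℕ.m≤m+n 6 6) (ℕ.*-monoʳ-≤ 3 4≤r)) ⟩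
    32 * r + 3 * r
      ≡⟨ ℕ.*-distribʳ-+ r 32 3 ⟨
    35 * r ∎
    where
    m≤r : m ≤ r
    m≤r = s≤s⁻¹ (subst (m <_) rank≡ m<rank)

  long : ∀ m → m ≤ rank M → suc (suc (m * 4)) * 2 ≤ 35 * r
  long m m≤rank = begin
    suc (suc (m * 4)) * 2
      ≡⟨ solve 1 (λ m → (con 2 :+ m :* con 4) :* con 2 := con 8 :* m :+ con 4) refl m ⟩
    8 * m + 4
      ≤⟨ ℕ.+-monoˡ-≤ 4 (ℕ.*-monoʳ-≤ 8 (subst (m ≤_) rank≡ m≤rank)) ⟩
    8 * suc r + 4
      ≡⟨ solve 1 (λ r → con 8 :* (con 1 :+ r) :+ con 4 := con 8 :* r :+ con 12) refl r ⟩
    8 * r + 12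
      ≤⟨ ℕ.+-monoʳ-≤ (8 * r) (ℕ.≤-trans (ℕ.m≤m+n 12 96) (ℕ.*-monoʳ-≤ 27 4≤r)) ⟩
    8 * r + 27 * r
      ≡⟨ ℕ.*-distribʳ-+ r 8 27 ⟨
    35 * r ∎

  bound : ∀ {k} → 35 * r ≤ k → n ≤ k / 2
  bound 35r≤k = element-bound simple loose (¬coloop t)
    (λ m m< → ≤-/2 (ℕ.≤-trans (short m m<) 35r≤k))
    (λ m m≤ → ≤-/2 (ℕ.≤-trans (long m m≤) 35r≤k))
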